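{- Adding an edge between two distinct, nonadjacent vertices of a connected graph can decrease the density by an amount arbitrarily close to $1/3$. That is, for every $\varepsilon>0$ there exist a connected graph $G$ and two distinct, nonadjacent vertices $u,v$ of $G$ such that, writing $H$ for the graph obtained from $G$ by adding the edge $uv$, $$\left|\big(\mathrm{Den}(G)-\mathrm{Den}(H)\big)-\tfrac13\right|<\varepsilon .$$
   Context: Graphs are finite, loopless, and have no multiple edges. A subtree of a graph $G$ is a (not necessarily induced) subgraph of $G$ that is a tree; the null graph (with no vertices) is not counted as a subtree, while single vertices are. Let $\mathcal{T}_G$ be the set of subtrees of $G$. The subtree polynomial of $G$ is $S_G(x)=\sum_{T\in\mathcal{T}_G}x^{|V(T)|}$. The mean subtree order of $G$ is the average order (number of vertices) of a subtree of $G$, that is, $\mu(G)=S_G'(1)/S_G(1)$. If $G$ has order $n$ (i.e., $n$ vertices), the density of $G$ is $\mathrm{Den}(G)=\mu(G)/n$. -}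

module Defs where

open import Level using (0ℓ)
open import Data.Nat.Base as ℕ using (ℕ; zero; suc; _+_; _*_; _≤_; z≤n; s≤s; NonZero)
import Data.Nat.Properties as ℕ
open import Data.Nat.ListAction using (sum)
open import Data.Nat.Tactic.RingSolver using (solve-∀)
open import Data.Bool.Base using (true; false)
import Data.Integer.Base as ℤ
open import Data.Rational.Base as ℚ using (ℚ)
open import Data.Fin.Base using (Fin; zero; suc)
open import Data.Fin.Properties using (_≟_; any?; all?; injective⇒≤)
open import Data.Fin.Subset using (Subset; _∈_; Nonempty; ⊤; ⊥; ⁅_⁆; ∣_∣)
open import Data.Fin.Subset.Properties using (_∈?_; nonempty?; x∈⁅x⁆; x∈⁅y⁆⇒x≡y; ∉⊥)
open import Data.Vec.Base as Vec using (Vec; []; _∷_)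
open import Data.Vec.Properties using (∷-injective; lookup-replicate)
open import Data.List.Base as List
  using (List; []; _∷_; _∷ʳ_; [_]; length; map; foldr; filter; allFin; cartesianProductWith)
open import Data.List.Relation.Unary.Any using (here; there)
open import Data.List.Relation.Unary.All as All using (All)
open import Data.List.Relation.Unary.AllPairs using ([]; _∷_)
open import Data.List.Relation.Unary.Linked using (Linked; linked?; _∷_)
open import Data.List.Relation.Unary.Unique.Propositional using (Unique)
import Data.List.Relation.Unary.Unique.Propositional.Properties as Unique
import Data.List.Relation.Unary.Unique.DecPropositional as DecUnique
open import Data.List.Membership.Propositional using () renaming (_∈_ to _∈ˡ_)
open import Data.List.Membership.Propositional.Properties
  using (∈-cartesianProductWith⁺; ∈-filter⁺; ∈-filter⁻; ∈-allFin; ∈-lookup)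
open import Data.Product.Base using (∃; ∃₂; _×_; _,_; proj₁; proj₂)
open import Data.Sum.Base as Sum using (_⊎_; inj₁; inj₂)
open import Function.Base using (_∘_)
open import Relation.Binary.Core using (Rel)
open import Relation.Binary.Definitions using (Decidable; Symmetric; Irreflexive)
open import Relation.Binary.Construct.Closure.ReflexiveTransitive using (Star; ε; _◅_; _◅◅_)
open import Relation.Binary.PropositionalEquality using (_≡_; _≢_; refl; sym; trans; cong; subst)
open import Relation.Nullary using (¬_; Dec; contradiction)
open import Relation.Nullary.Decidable using (map′; ¬?; _×-dec_; _⊎-dec_; _→-dec_)
import Relation.Unary as U

private
  variable
    n : ℕ

record Graph (n : ℕ) : Set₁ where
  field
    Adj        : Rel (Fin n) 0ℓ
    adj?       : Decidable Adj
    adj-sym    : Symmetric Adj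
    adj-irrefl : Irreflexive _≡_ Adj

open Graph public using (Adj; adj?)

addEdge : (G : Graph n) (u v : Fin n) → u ≢ v → Graph n
addEdge G u v u≢v = record
  { Adj        = λ i j → Adj G i j ⊎ ((i ≡ u × j ≡ v) ⊎ (i ≡ v × j ≡ u))
  ; adj?       = λ i j → adj? G i j ⊎-dec
                   ((i ≟ u ×-dec j ≟ v) ⊎-dec (i ≟ v ×-dec j ≟ u))
  ; adj-sym    = Sum.map (Graph.adj-sym G)
                   Sum.[ (λ (p , q) → inj₂ (q , p)) , (λ (p , q) → inj₁ (q , p)) ]
  ; adj-irrefl = λ where
      refl (inj₁ a)                    → Graph.adj-irrefl G refl a
      refl (inj₂ (inj₁ (refl , refl))) → u≢v refl
      refl (inj₂ (inj₂ (refl , refl))) → u≢v refl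
  }

-- V and E are separate so that this applies both to a graph and to a subgraph.
-- For a graph (with V = ⊤) and for a subgraph in the sense of IsSubgraph below,
-- E relates only elements of V, so that the walks stay inside V.
ConnectedOn : Subset n → Rel (Fin n) 0ℓ → Set
ConnectedOn V E = Nonempty V × (∀ i j → i ∈ V → j ∈ V → Star E i j)

Connected : Graph n → Set
Connected G = ConnectedOn ⊤ (Adj G)

-- The cycle x y₁ … yₖ x with k ≥ 2 and x, y₁, …, yₖ pairwise distinct.
IsCycle : Rel (Fin n) 0ℓ → Fin n → List (Fin n) → Set
IsCycle E x ys = 2 ≤ length ys × Unique (x ∷ ys) × Linked E (x ∷ ys ∷ʳ x)

Acyclic : Rel (Fin n) 0ℓ → Set
Acyclic E = ¬ ∃₂ (IsCycle E)

-- A vertex set and an edge set, the latter given by its adjacency matrix: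
-- row i is the set of neighbours of i.
record Subgraph (n : ℕ) : Set where
  constructor ⟨_,_⟩
  field
    vertices : Subset n
    edges    : Vec (Subset n) n

open Subgraph public

Edge : Subgraph n → Rel (Fin n) 0ℓ
Edge T i j = j ∈ Vec.lookup (edges T) i

order : Subgraph n → ℕ
order T = ∣ vertices T ∣

-- The other endpoint of an edge is covered by the symmetry.
IsSubgraph : Graph n → Subgraph n → Set
IsSubgraph G T = ∀ i j → Edge T i j → Edge T j i × Adj G i j × i ∈ vertices T

IsTree : Subgraph n → Set
IsTree T = ConnectedOn (vertices T) (Edge T) × Acyclic (Edge T)

IsSubtree : Graph n → Subgraph n → Set
IsSubtree G T = IsSubgraph G T × IsTree T

module _ {E : Rel (Fin n) 0ℓ} (E? : Decidable E) where

  -- Joined ks i j: there is a walk from i to j all of whose intermediate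
  -- vertices are in ks.
  private
    Joined : List (Fin n) → Rel (Fin n) 0ℓ
    Joined []       i j = i ≡ j ⊎ E i j
    Joined (k ∷ ks) i j = Joined ks i j ⊎ (Joined ks i k × Joined ks k j)

    joined? : ∀ ks → Decidable (Joined ks)
    joined? []       i j = i ≟ j ⊎-dec E? i j
    joined? (k ∷ ks) i j = joined? ks i j ⊎-dec (joined? ks i k ×-dec joined? ks k j)

    sound : ∀ ks {i j} → Joined ks i j → Star E i j
    sound []       (inj₁ refl)    = ε
    sound []       (inj₂ e)       = e ◅ ε
    sound (k ∷ ks) (inj₁ p)       = sound ks p
    sound (k ∷ ks) (inj₂ (p , q)) = sound ks p ◅◅ sound ks q

    weaken : ∀ ks {i j} → Joined [] i j → Joined ks i j
    weaken []       p = p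
    weaken (k ∷ ks) p = inj₁ (weaken ks p)

    through : ∀ ks {i j m} → m ∈ˡ ks → Joined ks i m → Joined ks m j → Joined ks i j
    through (k ∷ ks) (here refl) p q = inj₂ (Sum.[ (λ r → r) , proj₁ ] p , Sum.[ (λ r → r) , proj₂ ] q)
    through (k ∷ ks) (there m∈) (inj₁ p)       (inj₁ q)       = inj₁ (through ks m∈ p q)
    through (k ∷ ks) (there m∈) (inj₁ p)       (inj₂ (q , r)) = inj₂ (through ks m∈ p q , r)
    through (k ∷ ks) (there m∈) (inj₂ (p , q)) (inj₁ r)       = inj₂ (p , through ks m∈ q r)
    through (k ∷ ks) (there m∈) (inj₂ (p , q)) (inj₂ (r , s)) = inj₂ (p , s)

    complete : ∀ {i j} → Star E i j → Joined (allFin n) i j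
    complete ε       = weaken (allFin n) (inj₁ refl)
    complete (e ◅ w) = through (allFin n) (∈-allFin _) (weaken (allFin n) (inj₂ e)) (complete w)

  star? : Decidable (Star E)
  star? i j = map′ (sound (allFin n)) complete (joined? (allFin n) i j)

  connectedOn? : ∀ V → Dec (ConnectedOn V E)
  connectedOn? V = nonempty? V ×-dec
    all? (λ i → all? (λ j → i ∈? V →-dec (j ∈? V →-dec star? i j)))

private
  lookup-injective : {xs : List (Fin n)} → Unique xs →
                     ∀ {i j} → List.lookup xs i ≡ List.lookup xs j → i ≡ j
  lookup-injective (x∉ ∷ u) {zero}  {zero}  eq = refl
  lookup-injective (x∉ ∷ u) {zero}  {suc j} eq = contradiction eq (All.lookup x∉ (∈-lookup j))
  lookup-injective (x∉ ∷ u) {suc i} {zero}  eq = contradiction (sym eq) (All.lookup x∉ (∈-lookup i))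
  lookup-injective (x∉ ∷ u) {suc i} {suc j} eq = cong suc (lookup-injective u eq)

  anyList≤? : ∀ k {P : List (Fin n) → Set} → U.Decidable P →
              Dec (∃ λ xs → length xs ≤ k × P xs)
  anyList≤? zero P? = map′ (λ p → [] , z≤n , p) (λ { ([] , _ , p) → p }) (P? [])
  anyList≤? (suc k) P? = map′
    Sum.[ (λ p → [] , z≤n , p) , (λ (x , xs , l , p) → x ∷ xs , s≤s l , p) ]
    (λ { ([] , _ , p) → inj₁ p ; (x ∷ xs , s≤s l , p) → inj₂ (x , xs , l , p) })
    (P? [] ⊎-dec any? (λ x → anyList≤? k (P? ∘ (x ∷_))))

unique-length≤ : {xs : List (Fin n)} → Unique xs → length xs ≤ n
unique-length≤ u = injective⇒≤ (lookup-injective u)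

acyclic? : {E : Rel (Fin n) 0ℓ} → Decidable E → Dec (Acyclic E)
acyclic? {n} E? = ¬? (any? (λ x → map′
  (λ (ys , _ , c) → ys , c)
  (λ (ys , c@(_ , u , _)) → ys , ℕ.≤-trans (ℕ.n≤1+n _) (unique-length≤ u) , c)
  (anyList≤? n (λ ys → (2 ℕ.≤? length ys) ×-dec (DecUnique.unique? _≟_ (x ∷ ys) ×-dec linked? E? (x ∷ ys ∷ʳ x))))))

edge? : (T : Subgraph n) → Decidable (Edge T)
edge? T i j = j ∈? Vec.lookup (edges T) i

isSubtree? : (G : Graph n) → U.Decidable (IsSubtree G)
isSubtree? G T =
  all? (λ i → all? (λ j → edge? T i j →-dec
    (edge? T j i ×-dec (adj? G i j ×-dec i ∈? vertices T))))
  ×-dec (connectedOn? (edge? T) (vertices T) ×-dec acyclic? (edge? T))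

vectors : {A : Set} → List A → ∀ n → List (Vec A n)
vectors xs zero    = [ [] ]
vectors xs (suc n) = cartesianProductWith _∷_ xs (vectors xs n)

subsets : ∀ n → List (Subset n)
subsets = vectors (true ∷ false ∷ [])

subgraphs : ∀ n → List (Subgraph n)
subgraphs n = cartesianProductWith ⟨_,_⟩ (subsets n) (vectors (subsets n) n)

-- A list without repetitions of all the subtrees; see subtrees-complete,
-- subtrees-sound and subtrees-unique.
subtrees : Graph n → List (Subgraph n)
subtrees {n} G = filter (isSubtree? G) (subgraphs n)

private
  ∈-vectors : ∀ {A : Set} {xs : List A} → (∀ x → x ∈ˡ xs) → (v : Vec A n) → v ∈ˡ vectors xs n
  ∈-vectors all []      = here refl
  ∈-vectors all (x ∷ v) = ∈-cartesianProductWith⁺ _∷_ (all x) (∈-vectors all v)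

  ∈-subsets : (s : Subset n) → s ∈ˡ subsets n
  ∈-subsets = ∈-vectors λ { true → here refl ; false → there (here refl) }

  vectors-unique : ∀ {A : Set} {xs : List A} → Unique xs → ∀ n → Unique (vectors xs n)
  vectors-unique u zero    = All.[] ∷ []
  vectors-unique u (suc n) = Unique.cartesianProductWith⁺ _∷_ ∷-injective u (vectors-unique u n)

  subsets-unique : ∀ n → Unique (subsets n)
  subsets-unique = vectors-unique (((λ ()) All.∷ All.[]) ∷ (All.[] ∷ []))

subtrees-complete : (G : Graph n) {T : Subgraph n} → IsSubtree G T → T ∈ˡ subtrees G
subtrees-complete G {⟨ V , E ⟩} = ∈-filter⁺ (isSubtree? G)
  (∈-cartesianProductWith⁺ ⟨_,_⟩ (∈-subsets V) (∈-vectors ∈-subsets E))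

subtrees-sound : (G : Graph n) {T : Subgraph n} → T ∈ˡ subtrees G → IsSubtree G T
subtrees-sound {n} G T∈ = proj₂ (∈-filter⁻ (isSubtree? G) {xs = subgraphs n} T∈)

subtrees-unique : (G : Graph n) → Unique (subtrees G)
subtrees-unique {n} G = Unique.filter⁺ (isSubtree? G)
  (Unique.cartesianProductWith⁺ ⟨_,_⟩ (λ { refl → refl , refl })
    (subsets-unique n) (vectors-unique (subsets-unique n) n))

-- Coefficients, starting with the constant one.
Poly : Set
Poly = List ℕ

infixl 6 _⊞_

_⊞_ : Poly → Poly → Poly
[]      ⊞ q       = q
(a ∷ p) ⊞ []      = a ∷ p
(a ∷ p) ⊞ (b ∷ q) = a + b ∷ p ⊞ q

x^_ : ℕ → Poly
x^ zero  = [ 1 ]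
x^ suc k = 0 ∷ x^ k

eval : Poly → ℕ → ℕ
eval []      x = 0
eval (a ∷ p) x = a + x * eval p x

-- (a + x p)′ = p + x p′
deriv : Poly → Poly
deriv []      = []
deriv (a ∷ p) = p ⊞ (0 ∷ deriv p)

eval-⊞ : ∀ p q x → eval (p ⊞ q) x ≡ eval p x + eval q x
eval-⊞ []      q       x = refl
eval-⊞ (a ∷ p) []      x = sym (ℕ.+-identityʳ _)
eval-⊞ (a ∷ p) (b ∷ q) x rewrite eval-⊞ p q x = lemma a b x (eval p x) (eval q x)
  where
  lemma : ∀ a b x p q → a + b + x * (p + q) ≡ a + x * p + (b + x * q)
  lemma = solve-∀

eval-deriv-⊞ : ∀ p q x → eval (deriv (p ⊞ q)) x ≡ eval (deriv p) x + eval (deriv q) x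
eval-deriv-⊞ []      q       x = refl
eval-deriv-⊞ (a ∷ p) []      x = sym (ℕ.+-identityʳ _)
eval-deriv-⊞ (a ∷ p) (b ∷ q) x
  rewrite eval-⊞ (p ⊞ q) (0 ∷ deriv (p ⊞ q)) x | eval-⊞ p (0 ∷ deriv p) x
        | eval-⊞ q (0 ∷ deriv q) x | eval-⊞ p q x | eval-deriv-⊞ p q x
  = lemma x (eval p x) (eval q x) (eval (deriv p) x) (eval (deriv q) x)
  where
  lemma : ∀ x p q p′ q′ → p + q + x * (p′ + q′) ≡ p + x * p′ + (q + x * q′)
  lemma = solve-∀

eval-x^ : ∀ k → eval (x^ k) 1 ≡ 1
eval-x^ zero    = refl
eval-x^ (suc k) = trans (ℕ.+-identityʳ _) (eval-x^ k)

eval-deriv-x^ : ∀ k → eval (deriv (x^ k)) 1 ≡ k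
eval-deriv-x^ zero    = refl
eval-deriv-x^ (suc k)
  rewrite eval-⊞ (x^ k) (0 ∷ deriv (x^ k)) 1 | eval-x^ k | eval-deriv-x^ k
  = cong suc (ℕ.+-identityʳ k)

∑x^ : List (Subgraph n) → Poly
∑x^ = foldr (λ T p → x^ order T ⊞ p) []

subtreePolynomial : Graph n → Poly
subtreePolynomial G = ∑x^ (subtrees G)

private
  ∑x^-at-1 : (Ts : List (Subgraph n)) → eval (∑x^ Ts) 1 ≡ length Ts
  ∑x^-at-1 []       = refl
  ∑x^-at-1 (T ∷ Ts) rewrite eval-⊞ (x^ order T) (∑x^ Ts) 1 | eval-x^ (order T) =
    cong suc (∑x^-at-1 Ts)

  ∑x^-deriv-at-1 : (Ts : List (Subgraph n)) → eval (deriv (∑x^ Ts)) 1 ≡ sum (map order Ts)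
  ∑x^-deriv-at-1 []       = refl
  ∑x^-deriv-at-1 (T ∷ Ts)
    rewrite eval-deriv-⊞ (x^ order T) (∑x^ Ts) 1 | eval-deriv-x^ (order T) =
    cong (order T +_) (∑x^-deriv-at-1 Ts)

S-at-1 : (G : Graph n) → eval (subtreePolynomial G) 1 ≡ length (subtrees G)
S-at-1 G = ∑x^-at-1 (subtrees G)

S′-at-1 : (G : Graph n) → eval (deriv (subtreePolynomial G)) 1 ≡ sum (map order (subtrees G))
S′-at-1 G = ∑x^-deriv-at-1 (subtrees G)

singleVertex : Fin n → Subgraph n
singleVertex {n} i = ⟨ ⁅ i ⁆ , Vec.replicate n ⊥ ⟩

singleVertex-isSubtree : (G : Graph n) (i : Fin n) → IsSubtree G (singleVertex i)
singleVertex-isSubtree {n} G i =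
  (λ j k e → contradiction e (noEdge j k)) , ((i , x∈⁅x⁆ i) , connected) , acyclic
  where
  noEdge : ∀ j k → ¬ Edge (singleVertex i) j k
  noEdge j k e = ∉⊥ (subst (k ∈_) (lookup-replicate j ⊥) e)

  connected : ∀ j k → j ∈ ⁅ i ⁆ → k ∈ ⁅ i ⁆ → Star (Edge (singleVertex i)) j k
  connected j k p q rewrite x∈⁅y⁆⇒x≡y i p | x∈⁅y⁆⇒x≡y i q = ε

  acyclic : Acyclic (Edge (singleVertex i))
  acyclic (x , y ∷ ys , _ , _ , e ∷ _) = noEdge x y e

S-at-1-nonZero : .{{NonZero n}} → (G : Graph n) → NonZero (eval (subtreePolynomial G) 1)
S-at-1-nonZero {suc n} G rewrite S-at-1 G =
  nonEmpty (subtrees-complete G {singleVertex zero} (singleVertex-isSubtree G zero))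
  where
  nonEmpty : ∀ {T} {Ts : List (Subgraph (suc n))} → T ∈ˡ Ts → NonZero (length Ts)
  nonEmpty {Ts = _ ∷ _} _ = _

-- S′(1) / S(1), which by S-at-1 and S′-at-1 is the average order of a subtree.
μ : .{{NonZero n}} → Graph n → ℚ
μ G = ℚ._/_ (ℤ.+ eval (deriv (subtreePolynomial G)) 1) (eval (subtreePolynomial G) 1)
        {{S-at-1-nonZero G}}

Den : .{{NonZero n}} → Graph n → ℚ
Den {n} G = μ G ℚ.* (ℤ.+ 1 ℚ./ n)

{-# OPTIONS --safe #-}
module Submission where

-- Let G be a path from u to v with k edges and with s further leaves at u and s at v, where s is
-- small compared with k, and k² is small compared with 2^s.  Almost all subtrees
-- of G contain both u and v, hence the whole path, so that Den G tends to 1.  In H = G + uv these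
-- 4^s subtrees are outnumbered by the k (k + 1) / 2 · 4^s subtrees which use the edge uv.  The
-- latter omit a nonempty interval of edges of the path and on average keep 2/3 of its vertices,
-- so that Den H tends to 2/3.

-- A subtree of `G` that misses an end of the path is a single leaf or has leaves at one end at
-- most. Apart from the single leaves, an interval of the path and a set of leaves at one end
-- determine it, which leaves about k² 2^s possibilities against 4^s. The value 2/3 arises as a
-- mean. A gap leaving t + 2 path vertices can be placed in t + 1 ways, so in the limit the
-- remaining proportion x of the path has density 2x on [0, 1]. Subtrees are adjacency matrices, so
-- each of them is brought into a normal form: a vertex set with the edges induced on it by a
-- relation `Parent d`, rooted at 0. The case d = k serves `G`, the cases d < k serve the subtrees
-- with the chord. That such a subgraph is a tree follows from unique parents and a rank decreasing
-- towards the root; conversely, connectedness and the absence of cycles force every subtree into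
-- this form. Nothing is counted exactly: lists of genuine subtrees without repetitions give lower
-- bounds, covering lists give upper bounds, and all errors are O(1/y) for a parameter y.

open import Defs

-- Inequalities between the counts.

module Arithmetic where

  open import Data.Nat.Base using (ℕ; zero; suc; _+_; _*_; _^_; _≤_; _<_; z≤n; s≤s; NonZero; >-nonZero)
  open import Data.Nat.Properties
  open import Data.Nat.Tactic.RingSolver using (solve-∀)
  open import Relation.Binary.PropositionalEquality

  -- B counts the sets of leaves, M the gaps which a subtree can leave in the path and E the exceptional
  -- subtrees; O is the total number of path vertices outside the gap, summed over the gaps.
  module Estimates {B E M O k r y n : ℕ} (n≡ : n ≡ suc k + r) (1≤y : 1 ≤ y) (y²≤k : y * y ≤ k)
                   (r≤10y : r ≤ 10 * y) (E≤ : E * y ≤ 20 * B)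
                   (M≡ : 2 * M ≡ k * suc k) (O≡ : 3 * O ≡ k * suc k * suc (suc k)) where

    open ≤-Reasoning

    private
      instance
        y≢0 : NonZero y
        y≢0 = >-nonZero 1≤y

    k+1≤n : suc k ≤ n
    k+1≤n = subst (suc k ≤_) (sym n≡) (m≤m+n (suc k) r)

    y≤k : y ≤ k
    y≤k = ≤-trans (m≤m*n y y) y²≤k

    y≤n : y ≤ n
    y≤n = ≤-trans y≤k (≤-trans (n≤1+n k) k+1≤n)

    ry≤10n : r * y ≤ 10 * n
    ry≤10n = begin
      r * y          ≤⟨ *-monoˡ-≤ y r≤10y ⟩
      10 * y * y     ≡⟨ *-assoc 10 y y ⟩
      10 * (y * y)   ≤⟨ *-monoʳ-≤ 10 (≤-trans y²≤k (≤-trans (n≤1+n k) k+1≤n)) ⟩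
      10 * n         ∎

    y≤M : y ≤ M
    y≤M = *-cancelˡ-≤ 2 (begin
      2 * y      ≡⟨ *-comm 2 y ⟩
      y * 2      ≤⟨ *-mono-≤ y≤k (s≤s (≤-trans 1≤y y≤k)) ⟩
      k * suc k  ≡⟨ M≡ ⟨
      2 * M      ∎)

    -- Here 2/3 enters: O / M = 2 (k + 2) / 3 path vertices remain on average. The right-hand side
    -- separates the main term 2 M (k + 1) from the error 2 M.
    3O≡ : 3 * O ≡ 2 * M * suc k + 2 * M
    3O≡ = trans O≡ (trans (cong (_* suc (suc k)) (sym M≡)) (trans (*-suc (2 * M) (suc k)) (+-comm (2 * M) _)))

    -- Divided by S n y, this is 1 ≤ S′ / (S n) + 30 / y. Of the 30, the leaves cost 10, because r /
    -- n ≤ 10 / y, and the exceptional subtrees cost 20.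
    G-lower : ∀ {S S′} → B ≤ S → S ≤ B + E → B * suc k ≤ S′ → S * n * y ≤ S′ * y + 30 * (S * n)
    G-lower {S} {S′} B≤S S≤ ≤S′ = begin
      S * n * y
        ≤⟨ *-monoˡ-≤ y (*-monoˡ-≤ n S≤) ⟩
      (B + E) * n * y
        ≡⟨ identity₁ B E n y ⟩
      B * n * y + E * y * n
        ≤⟨ +-monoʳ-≤ (B * n * y) (*-monoˡ-≤ n E≤) ⟩
      B * n * y + 20 * B * n
        ≡⟨ cong (λ n′ → B * n′ * y + 20 * B * n) n≡ ⟩
      B * (suc k + r) * y + 20 * B * n
        ≡⟨ identity₂ B (suc k) r y n ⟩
      B * suc k * y + (B * (r * y) + 20 * (B * n))
        ≤⟨ +-mono-≤ (*-monoˡ-≤ y ≤S′) (+-monoˡ-≤ (20 * (B * n)) (*-monoʳ-≤ B ry≤10n)) ⟩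
      S′ * y + (B * (10 * n) + 20 * (B * n))
        ≡⟨ identity₃ B n (S′ * y) ⟩
      S′ * y + 30 * (B * n)
        ≤⟨ +-monoʳ-≤ (S′ * y) (*-monoʳ-≤ 30 (*-monoˡ-≤ n B≤S)) ⟩
      S′ * y + 30 * (S * n) ∎
      where
      identity₁ : ∀ B E n y → (B + E) * n * y ≡ B * n * y + E * y * n
      identity₁ = solve-∀
      identity₂ : ∀ B k r y n → B * (k + r) * y + 20 * B * n ≡ B * k * y + (B * (r * y) + 20 * (B * n))
      identity₂ = solve-∀
      identity₃ : ∀ B n x → x + (B * (10 * n) + 20 * (B * n)) ≡ x + 30 * (B * n)
      identity₃ = solve-∀

    Bn≤BMn : B * n ≤ B * M * n
    Bn≤BMn = *-monoˡ-≤ n (m≤m*n B M {{>-nonZero (≤-trans 1≤y y≤M)}})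

    -- This makes the B subtrees of `H` that contain the whole path but not the chord an error term:
    -- their share is at most 1 / M ≤ 1 / y.
    Bny≤BMn : B * n * y ≤ B * M * n
    Bny≤BMn = begin
      B * n * y  ≤⟨ *-monoʳ-≤ (B * n) y≤M ⟩
      B * n * M  ≡⟨ identity B n M ⟩
      B * M * n  ∎
      where
      identity : ∀ B n M → B * n * M ≡ B * M * n
      identity = solve-∀

    -- The constant is 62 = 2 · 10 + 2 + 2 · 20, from the leaves, the full trees without the chord,
    -- and the exceptional subtrees.
    H-lower : ∀ {S S′} → B * M ≤ S → S ≤ B * M + (B + E) → B * O ≤ S′ →
              2 * (S * n * y) ≤ 3 * (S′ * y) + 62 * (S * n)
    H-lower {S} {S′} ≤S S≤ ≤S′ = begin
      2 * (S * n * y)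
        ≤⟨ *-monoʳ-≤ 2 (*-monoˡ-≤ y (*-monoˡ-≤ n S≤)) ⟩
      2 * ((B * M + (B + E)) * n * y)
        ≡⟨ identity₁ B M E n y ⟩
      2 * M * n * (B * y) + (2 * (B * n * y) + 2 * (E * y * n))
        ≤⟨ +-monoʳ-≤ (2 * M * n * (B * y)) (+-mono-≤ (*-monoʳ-≤ 2 Bny≤BMn) (*-monoʳ-≤ 2 (*-monoˡ-≤ n E≤))) ⟩
      2 * M * n * (B * y) + (2 * (B * M * n) + 2 * (20 * B * n))
        ≡⟨ cong (λ n′ → 2 * M * n′ * (B * y) + (2 * (B * M * n) + 2 * (20 * B * n))) n≡ ⟩
      2 * M * (suc k + r) * (B * y) + (2 * (B * M * n) + 2 * (20 * B * n))
        ≡⟨ identity₂ M (suc k) r B y n ⟩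
      2 * M * suc k * (B * y) + (2 * (B * M * (r * y)) + 2 * (B * M * n) + 40 * (B * n))
        ≤⟨ +-mono-≤ (*-monoˡ-≤ (B * y) (m≤m+n (2 * M * suc k) (2 * M)))
             (+-mono-≤ (+-monoˡ-≤ (2 * (B * M * n)) (*-monoʳ-≤ 2 (*-monoʳ-≤ (B * M) ry≤10n))) (*-monoʳ-≤ 40 Bn≤BMn)) ⟩
      (2 * M * suc k + 2 * M) * (B * y) + (2 * (B * M * (10 * n)) + 2 * (B * M * n) + 40 * (B * M * n))
        ≡⟨ cong (λ o → o * (B * y) + (2 * (B * M * (10 * n)) + 2 * (B * M * n) + 40 * (B * M * n))) 3O≡ ⟨
      3 * O * (B * y) + (2 * (B * M * (10 * n)) + 2 * (B * M * n) + 40 * (B * M * n))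
        ≡⟨ identity₃ O B y (B * M) n ⟩
      3 * (B * O * y) + 62 * (B * M * n)
        ≤⟨ +-mono-≤ (*-monoʳ-≤ 3 (*-monoˡ-≤ y ≤S′)) (*-monoʳ-≤ 62 (*-monoˡ-≤ n ≤S)) ⟩
      3 * (S′ * y) + 62 * (S * n) ∎
      where
      identity₁ : ∀ B M E n y → 2 * ((B * M + (B + E)) * n * y) ≡ 2 * M * n * (B * y) + (2 * (B * n * y) + 2 * (E * y * n))
      identity₁ = solve-∀
      identity₂ : ∀ M k r B y n → 2 * M * (k + r) * (B * y) + (2 * (B * M * n) + 2 * (20 * B * n)) ≡
                  2 * M * k * (B * y) + (2 * (B * M * (r * y)) + 2 * (B * M * n) + 40 * (B * n))
      identity₂ = solve-∀
      identity₃ : ∀ O B y x n → 3 * O * (B * y) + (2 * (x * (10 * n)) + 2 * (x * n) + 40 * (x * n)) ≡ 3 * (B * O * y) + 62 * (x * n)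
      identity₃ = solve-∀

    -- The constant is 95 = 2 + 3 · 10 + 3 + 3 · 20, from the error term of `3O≡`, the leaves, the
    -- full trees without the chord, and the exceptional subtrees.
    H-upper : ∀ {S S′} → B * M ≤ S → S′ ≤ B * (O + M * r) + (B + E) * n →
              3 * (S′ * y) ≤ 2 * (S * n * y) + 95 * (S * n)
    H-upper {S} {S′} ≤S S′≤ = begin
      3 * (S′ * y)
        ≤⟨ *-monoʳ-≤ 3 (*-monoˡ-≤ y S′≤) ⟩
      3 * ((B * (O + M * r) + (B + E) * n) * y)
        ≡⟨ identity₁ B O M r E n y ⟩
      3 * O * (B * y) + (3 * (B * M * (r * y)) + 3 * (B * n * y) + 3 * (E * y * n))
        ≡⟨ cong (λ o → o * (B * y) + (3 * (B * M * (r * y)) + 3 * (B * n * y) + 3 * (E * y * n))) 3O≡ ⟩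
      (2 * M * suc k + 2 * M) * (B * y) + (3 * (B * M * (r * y)) + 3 * (B * n * y) + 3 * (E * y * n))
        ≡⟨ identity₂ M (suc k) B y _ ⟩
      2 * (B * M * suc k * y) + 2 * (B * M * y) + (3 * (B * M * (r * y)) + 3 * (B * n * y) + 3 * (E * y * n))
        ≤⟨ +-mono-≤ (+-mono-≤ (*-monoʳ-≤ 2 (*-monoˡ-≤ y (*-monoʳ-≤ (B * M) k+1≤n))) (*-monoʳ-≤ 2 (*-monoʳ-≤ (B * M) y≤n)))
             (+-mono-≤ (+-mono-≤ (*-monoʳ-≤ 3 (*-monoʳ-≤ (B * M) ry≤10n)) (*-monoʳ-≤ 3 Bny≤BMn))
               (*-monoʳ-≤ 3 (*-monoˡ-≤ n E≤))) ⟩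
      2 * (B * M * n * y) + 2 * (B * M * n) + (3 * (B * M * (10 * n)) + 3 * (B * M * n) + 3 * (20 * B * n))
        ≡⟨ identity₃ (B * M) n y B ⟩
      2 * (B * M * n * y) + 35 * (B * M * n) + 60 * (B * n)
        ≤⟨ +-monoʳ-≤ (2 * (B * M * n * y) + 35 * (B * M * n)) (*-monoʳ-≤ 60 Bn≤BMn) ⟩
      2 * (B * M * n * y) + 35 * (B * M * n) + 60 * (B * M * n)
        ≡⟨ identity₄ (B * M * n * y) (B * M * n) ⟩
      2 * (B * M * n * y) + 95 * (B * M * n)
        ≤⟨ +-mono-≤ (*-monoʳ-≤ 2 (*-monoˡ-≤ y (*-monoˡ-≤ n ≤S))) (*-monoʳ-≤ 95 (*-monoˡ-≤ n ≤S)) ⟩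
      2 * (S * n * y) + 95 * (S * n) ∎
      where
      identity₁ : ∀ B O M r E n y → 3 * ((B * (O + M * r) + (B + E) * n) * y) ≡
                  3 * O * (B * y) + (3 * (B * M * (r * y)) + 3 * (B * n * y) + 3 * (E * y * n))
      identity₁ = solve-∀
      identity₂ : ∀ M k B y z → (2 * M * k + 2 * M) * (B * y) + z ≡ 2 * (B * M * k * y) + 2 * (B * M * y) + z
      identity₂ = solve-∀
      identity₃ : ∀ x n y B → 2 * (x * n * y) + 2 * (x * n) + (3 * (x * (10 * n)) + 3 * (x * n) + 3 * (20 * B * n)) ≡
                  2 * (x * n * y) + 35 * (x * n) + 60 * (B * n)
      identity₃ = solve-∀
      identity₄ : ∀ x z → 2 * x + 35 * z + 60 * z ≡ 2 * x + 95 * z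
      identity₄ = solve-∀

  n<2^n : ∀ n → n < 2 ^ n
  n<2^n zero    = s≤s z≤n
  n<2^n (suc n) = begin-strict
    suc n                 ≡⟨ +-comm 1 n ⟩
    n + 1                 <⟨ +-mono-<-≤ (n<2^n n) (≤-trans (s≤s z≤n) (n<2^n n)) ⟩
    2 ^ n + 2 ^ n         ≡⟨ cong (2 ^ n +_) (+-identityʳ (2 ^ n)) ⟨
    2 ^ suc n ∎
    where open ≤-Reasoning

  -- With k = y² and 2 ^ s = y⁵ the relation is E = O(y⁹), against B = y¹⁰.
  exceptions-few : ∀ {y r} → 1 ≤ y → r ≤ 10 * y → let L = y * y * y * y * y in
    (suc (y * y) + r + suc (y * y) * suc (y * y) * (L + L)) * y ≤ 20 * (L * L)
  exceptions-few {suc y} {r} _ r≤ = begin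
    (suc (Y * Y) + r + suc (Y * Y) * suc (Y * Y) * (L + L)) * Y
      ≤⟨ *-monoˡ-≤ Y (+-mono-≤ (+-mono-≤ 1+Y²≤ (≤-trans r≤ 10Y≤)) (*-monoˡ-≤ (L + L) (*-mono-≤ 1+Y²≤ 1+Y²≤))) ⟩
    (2 * (Y * Y) + 10 * (Y * Y) + 2 * (Y * Y) * (2 * (Y * Y)) * (L + L)) * Y
      ≡⟨ identity₁ Y ⟩
    12 * (Y * Y * Y) + 8 * (L * L)
      -- The lower-order term Y³ is enlarged to Y¹⁰ = L², so that 12 + 8 = 20 is the final constant.
      ≤⟨ +-monoˡ-≤ (8 * (L * L)) (*-monoʳ-≤ 12 (m≤m*n (Y * Y * Y) (Y * Y * Y * Y * Y * Y * Y) {{_}})) ⟩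
    12 * (Y * Y * Y * (Y * Y * Y * Y * Y * Y * Y)) + 8 * (L * L)
      ≡⟨ identity₂ Y ⟩
    20 * (L * L) ∎
    where
    open ≤-Reasoning
    Y L : ℕ
    Y = suc y
    L = Y * Y * Y * Y * Y
    1+Y²≤ : suc (Y * Y) ≤ 2 * (Y * Y)
    1+Y²≤ = subst (suc (Y * Y) ≤_) (cong (Y * Y +_) (sym (+-identityʳ (Y * Y)))) (+-monoˡ-≤ (Y * Y) (s≤s z≤n))
    10Y≤ : 10 * Y ≤ 10 * (Y * Y)
    10Y≤ = *-monoʳ-≤ 10 (m≤m*n Y Y)
    identity₁ : ∀ Y → let L = Y * Y * Y * Y * Y in
      (2 * (Y * Y) + 10 * (Y * Y) + 2 * (Y * Y) * (2 * (Y * Y)) * (L + L)) * Y ≡ 12 * (Y * Y * Y) + 8 * (L * L)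
    identity₁ = solve-∀
    identity₂ : ∀ Y → let L = Y * Y * Y * Y * Y in
      12 * (Y * Y * Y * (Y * Y * Y * Y * Y * Y * Y)) + 8 * (L * L) ≡ 20 * (L * L)
    identity₂ = solve-∀

-- From the counts to densities as rational numbers.

module Densities where

  open Arithmetic
  open import Data.Nat.Base as ℕ using (ℕ; suc; NonZero)
  import Data.Nat.Properties as ℕ
  open import Data.Nat.Tactic.RingSolver using (solve-∀)
  open import Data.Integer.Base as ℤ using (+_; +≤+; +<+)
  import Data.Integer.Properties as ℤ
  open import Data.List.Base using (length; map)
  open import Data.Nat.ListAction using (sum)
  open import Data.Rational.Base using (ℚ; mkℚ; 0ℚ; 1ℚ; toℚᵘ; _+_; _*_; -_; _-_; _/_; _≤_; _<_; *<*; ∣_∣)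
  open import Data.Rational.Properties
  open import Data.Rational.Solver using (module +-*-Solver)
  open import Data.Rational.Unnormalised.Base as ℚᵘ using (ℚᵘ; mkℚᵘ; _≃_; *≤*; *<*)
  import Data.Rational.Unnormalised.Properties as ℚᵘ
  open import Data.Sum.Base using ([_,_]′)
  open import Relation.Binary.PropositionalEquality hiding ([_])

  toℚᵘ-/ : ∀ a b → toℚᵘ (+ a / suc b) ≃ mkℚᵘ (+ a) b
  toℚᵘ-/ a b = toℚᵘ-fromℚᵘ (mkℚᵘ (+ a) b)

  module _ (a S n : ℕ) .{{_ : NonZero S}} .{{_ : NonZero n}} where

    density : ℚ
    density = + a / S * (+ 1 / n)

  toℚᵘ-density : ∀ a S n → toℚᵘ (density a (suc S) (suc n)) ≃ mkℚᵘ (+ a) (n ℕ.+ S ℕ.* suc n)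
  toℚᵘ-density a S n = ℚᵘ.≃-trans (toℚᵘ-homo-* (+ a / suc S) (+ 1 / suc n))
    (ℚᵘ.≃-trans (ℚᵘ.*-cong (toℚᵘ-/ a S) (toℚᵘ-/ 1 n)) (ℚᵘ.≃-reflexive (cong (λ z → mkℚᵘ z _) (ℤ.*-identityʳ (+ a)))))

  toℚᵘ-/-+-/ : ∀ {p q a b c d} → toℚᵘ p ≃ mkℚᵘ (+ a) b → toℚᵘ q ≃ mkℚᵘ (+ c) d →
               toℚᵘ (p + q) ≃ mkℚᵘ (+ (a ℕ.* suc d ℕ.+ c ℕ.* suc b)) (d ℕ.+ b ℕ.* suc d)
  toℚᵘ-/-+-/ {p} {q} {a} {b} {c} {d} p≃ q≃ = ℚᵘ.≃-trans (toℚᵘ-homo-+ p q) (ℚᵘ.≃-trans (ℚᵘ.+-cong p≃ q≃)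
    (ℚᵘ.≃-reflexive (cong (λ z → mkℚᵘ z _)
      (sym (trans (ℤ.pos-+ (a ℕ.* suc d) _) (cong₂ ℤ._+_ (ℤ.pos-* a (suc d)) (ℤ.pos-* c (suc b))))))))

  -- Passing to unnormalised fractions keeps common divisors out of sight and leaves
  -- cross-multiplication over the natural numbers.
  cross-≤ : ∀ {p q a b c d} → toℚᵘ p ≃ mkℚᵘ (+ a) b → toℚᵘ q ≃ mkℚᵘ (+ c) d →
            a ℕ.* suc d ℕ.≤ c ℕ.* suc b → p ≤ q
  cross-≤ {p} {q} {a} {b} {c} {d} p≃ q≃ le = toℚᵘ-cancel-≤ (begin
    toℚᵘ p ≃⟨ p≃ ⟩
    mkℚᵘ (+ a) b ≤⟨ *≤* (subst₂ ℤ._≤_ (ℤ.pos-* a (suc d)) (ℤ.pos-* c (suc b)) (+≤+ le)) ⟩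
    mkℚᵘ (+ c) d ≃⟨ q≃ ⟨
    toℚᵘ q ∎)
    where open ℚᵘ.≤-Reasoning

  module _ (α β C y a S n : ℕ) .{{_ : NonZero β}} .{{_ : NonZero y}} .{{_ : NonZero S}} .{{_ : NonZero n}} where

    density-lower : α ℕ.* (S ℕ.* n ℕ.* y) ℕ.≤ β ℕ.* (a ℕ.* y) ℕ.+ β ℕ.* (C ℕ.* (S ℕ.* n)) →
                    + α / β ≤ density a S n + + C / y
    density-lower = lower α β C y a S n
      where
      lower : ∀ α β C y a S n .{{_ : NonZero β}} .{{_ : NonZero y}} .{{_ : NonZero S}} .{{_ : NonZero n}} →
              α ℕ.* (S ℕ.* n ℕ.* y) ℕ.≤ β ℕ.* (a ℕ.* y) ℕ.+ β ℕ.* (C ℕ.* (S ℕ.* n)) →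
              + α / β ≤ density a S n + + C / y
      lower α (suc β) C (suc y) a (suc S) (suc n) le =
        cross-≤ (toℚᵘ-/ α β) (toℚᵘ-/-+-/ {density a (suc S) (suc n)} (toℚᵘ-density a S n) (toℚᵘ-/ C y)) (ℕ.≤-trans le
          (ℕ.≤-reflexive (identity (suc β) (suc y) a (suc S ℕ.* suc n) C)))
        where
        identity : ∀ β y a z C → β ℕ.* (a ℕ.* y) ℕ.+ β ℕ.* (C ℕ.* z) ≡ (a ℕ.* y ℕ.+ C ℕ.* z) ℕ.* β
        identity = solve-∀

    density-upper : β ℕ.* (a ℕ.* y) ℕ.≤ α ℕ.* (S ℕ.* n ℕ.* y) ℕ.+ β ℕ.* (C ℕ.* (S ℕ.* n)) →
                    density a S n ≤ + α / β + + C / y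
    density-upper = upper α β C y a S n
      where
      upper : ∀ α β C y a S n .{{_ : NonZero β}} .{{_ : NonZero y}} .{{_ : NonZero S}} .{{_ : NonZero n}} →
              β ℕ.* (a ℕ.* y) ℕ.≤ α ℕ.* (S ℕ.* n ℕ.* y) ℕ.+ β ℕ.* (C ℕ.* (S ℕ.* n)) →
              density a S n ≤ + α / β + + C / y
      upper α (suc β) C (suc y) a (suc S) (suc n) le =
        cross-≤ (toℚᵘ-density a S n) (toℚᵘ-/-+-/ {+ α / suc β} (toℚᵘ-/ α β) (toℚᵘ-/ C y))
          (subst₂ ℕ._≤_ (identity₁ (suc β) a (suc y)) (identity₂ α (suc S ℕ.* suc n) (suc y) (suc β) C) le)
        where
        identity₁ : ∀ β a y → β ℕ.* (a ℕ.* y) ≡ a ℕ.* (β ℕ.* y)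
        identity₁ = solve-∀
        identity₂ : ∀ α z y β C → α ℕ.* (z ℕ.* y) ℕ.+ β ℕ.* (C ℕ.* z) ≡ (α ℕ.* y ℕ.+ C ℕ.* β) ℕ.* z
        identity₂ = solve-∀

  module _ {n : ℕ} .{{_ : NonZero n}} (K : Graph n) (α β C y : ℕ) .{{_ : NonZero β}} .{{_ : NonZero y}} where

    private
      instance
        S≢0 : NonZero (eval (subtreePolynomial K) 1)
        S≢0 = S-at-1-nonZero K

    Den-lower : α ℕ.* (length (subtrees K) ℕ.* n ℕ.* y) ℕ.≤
                β ℕ.* (sum (map order (subtrees K)) ℕ.* y) ℕ.+ β ℕ.* (C ℕ.* (length (subtrees K) ℕ.* n)) →
                + α / β ≤ Den K + + C / y
    Den-lower h = density-lower α β C y (eval (deriv (subtreePolynomial K)) 1) (eval (subtreePolynomial K) 1) n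
      (subst₂ (λ S S′ → α ℕ.* (S ℕ.* n ℕ.* y) ℕ.≤ β ℕ.* (S′ ℕ.* y) ℕ.+ β ℕ.* (C ℕ.* (S ℕ.* n)))
        (sym (S-at-1 K)) (sym (S′-at-1 K)) h)

    Den-upper : β ℕ.* (sum (map order (subtrees K)) ℕ.* y) ℕ.≤
                α ℕ.* (length (subtrees K) ℕ.* n ℕ.* y) ℕ.+ β ℕ.* (C ℕ.* (length (subtrees K) ℕ.* n)) →
                Den K ≤ + α / β + + C / y
    Den-upper h = density-upper α β C y (eval (deriv (subtreePolynomial K)) 1) (eval (subtreePolynomial K) 1) n
      (subst₂ (λ S S′ → β ℕ.* (S′ ℕ.* y) ℕ.≤ α ℕ.* (S ℕ.* n ℕ.* y) ℕ.+ β ℕ.* (C ℕ.* (S ℕ.* n)))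
        (sym (S-at-1 K)) (sym (S′-at-1 K)) h)

  -- Since 1 - 2/3 = 1/3, each sign of the absolute value costs one error of p and one of q.
  difference-near-1/3 : ∀ {p q e : ℚ} → p ≤ 1ℚ + e → 1ℚ ≤ p + e → q ≤ + 2 / 3 + e → + 2 / 3 ≤ q + e →
                        ∣ (p - q) - + 1 / 3 ∣ ≤ e + e
  difference-near-1/3 {p} {q} {e} p≤ ≤p q≤ ≤q =
    [ (λ eq → subst (_≤ e + e) (sym eq) above) , (λ eq → subst (_≤ e + e) (sym eq) below) ]′ (∣p∣≡p∨∣p∣≡-p _)
    where
    open +-*-Solver
    open ≤-Reasoning
    above : (p - q) - + 1 / 3 ≤ e + e
    above = begin
      (p - q) - + 1 / 3
        ≡⟨ solve 2 (λ p q → (p :- q) :- con (+ 1 / 3) := (p :+ con (+ 2 / 3)) :+ (:- q :- con 1ℚ)) refl p q ⟩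
      (p + + 2 / 3) + (- q - 1ℚ)
        ≤⟨ +-monoˡ-≤ (- q - 1ℚ) (+-mono-≤ p≤ ≤q) ⟩
      ((1ℚ + e) + (q + e)) + (- q - 1ℚ)
        ≡⟨ solve 2 (λ q e → ((con 1ℚ :+ e) :+ (q :+ e)) :+ (:- q :- con 1ℚ) := e :+ e) refl q e ⟩
      e + e ∎
    below : - ((p - q) - + 1 / 3) ≤ e + e
    below = begin
      - ((p - q) - + 1 / 3)
        ≡⟨ solve 2 (λ p q → :- ((p :- q) :- con (+ 1 / 3)) := (con 1ℚ :+ q) :+ (:- p :- con (+ 2 / 3))) refl p q ⟩
      (1ℚ + q) + (- p - + 2 / 3)
        ≤⟨ +-monoˡ-≤ (- p - + 2 / 3) (+-mono-≤ ≤p q≤) ⟩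
      ((p + e) + (+ 2 / 3 + e)) + (- p - + 2 / 3)
        ≡⟨ solve 2 (λ p e → ((p :+ e) :+ (con (+ 2 / 3) :+ e)) :+ (:- p :- con (+ 2 / 3)) := e :+ e) refl p e ⟩
      e + e ∎

  -- A positive rational with denominator d is at least 1 / d, and 2 c d < y says that 2 c / y is
  -- below that.
  archimedean : ∀ ε → 0ℚ < ε → ∀ c y .{{_ : NonZero y}} → 2 ℕ.* c ℕ.* ℚᵘ.↧ₙ (toℚᵘ ε) ℕ.< y →
                + c / y + + c / y < ε
  archimedean ε@(mkℚ (+ suc p) d _) 0<ε c (suc y) lt = toℚᵘ-cancel-< (begin-strict
    toℚᵘ (+ c / suc y + + c / suc y)
      ≃⟨ toℚᵘ-/-+-/ {+ c / suc y} (toℚᵘ-/ c y) (toℚᵘ-/ c y) ⟩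
    mkℚᵘ (+ (c ℕ.* suc y ℕ.+ c ℕ.* suc y)) (y ℕ.+ y ℕ.* suc y)
      <⟨ *<* (subst₂ ℤ._<_ (ℤ.pos-* (c ℕ.* suc y ℕ.+ c ℕ.* suc y) (suc d)) (ℤ.pos-* (suc p) (suc y ℕ.* suc y)) (+<+ cross)) ⟩
    toℚᵘ ε ∎)
    where
    open ℚᵘ.≤-Reasoning
    cross : (c ℕ.* suc y ℕ.+ c ℕ.* suc y) ℕ.* suc d ℕ.< suc p ℕ.* (suc y ℕ.* suc y)
    cross = ℕ.<-≤-trans (subst (ℕ._< suc y ℕ.* suc y) (identity c (suc y) (suc d)) (ℕ.*-monoˡ-< (suc y) lt))
      (ℕ.m≤m+n (suc y ℕ.* suc y) _)
      where
      identity : ∀ c y d → 2 ℕ.* c ℕ.* d ℕ.* y ≡ (c ℕ.* y ℕ.+ c ℕ.* y) ℕ.* d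
      identity = solve-∀
  archimedean (mkℚ (+ 0) _ _) (*<* (+<+ ()))
  archimedean (mkℚ (ℤ.-[1+ _ ]) _ _) (*<* ())

  -- Opaque, so that comparing two instances compares the graphs instead of unfolding Den.
  opaque

    GapNear1/3 : {m : ℕ} (G H : Graph (suc m)) (e : ℚ) → Set
    GapNear1/3 G H e = ∣ (Den G - Den H) - (+ 1 / 3) ∣ ≤ e

    nearby : {m : ℕ} {G H : Graph (suc m)} {e : ℚ} → ∣ (Den G - Den H) - (+ 1 / 3) ∣ ≤ e → GapNear1/3 G H e
    nearby d = d

    distance : {m : ℕ} {G H : Graph (suc m)} {e : ℚ} → GapNear1/3 G H e → ∣ (Den G - Den H) - (+ 1 / 3) ∣ ≤ e
    distance d = d

  module Limit {m : ℕ} (G H : Graph (suc m)) {B E M O k r y : ℕ} (n≡ : suc m ≡ suc k ℕ.+ r)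
    (1≤y : 1 ℕ.≤ y) (y²≤k : y ℕ.* y ℕ.≤ k) (r≤10y : r ℕ.≤ 10 ℕ.* y) (E≤ : E ℕ.* y ℕ.≤ 20 ℕ.* B)
    (M≡ : 2 ℕ.* M ≡ k ℕ.* suc k) (O≡ : 3 ℕ.* O ≡ k ℕ.* suc k ℕ.* suc (suc k))
    (#G≥ : B ℕ.≤ length (subtrees G)) (#G≤ : length (subtrees G) ℕ.≤ B ℕ.+ E)
    (∑G≥ : B ℕ.* suc k ℕ.≤ sum (map order (subtrees G))) (∑G≤ : sum (map order (subtrees G)) ℕ.≤ length (subtrees G) ℕ.* suc m)
    (#H≥ : B ℕ.* M ℕ.≤ length (subtrees H)) (#H≤ : length (subtrees H) ℕ.≤ B ℕ.* M ℕ.+ (B ℕ.+ E))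
    (∑H≥ : B ℕ.* O ℕ.≤ sum (map order (subtrees H)))
    (∑H≤ : sum (map order (subtrees H)) ℕ.≤ B ℕ.* (O ℕ.+ M ℕ.* r) ℕ.+ (B ℕ.+ E) ℕ.* suc m) where

    open Estimates {B} {E} {M} {O} {k} {r} {y} {suc m} n≡ 1≤y y²≤k r≤10y E≤ M≡ O≡

    instance
      y≢0 : NonZero y
      y≢0 = ℕ.>-nonZero 1≤y

    -- The three estimates have the constants 30, 62 and 95; the largest serves for all of them.
    e : ℚ
    e = + 95 / y

    private
      *-constant≤ : ∀ β {c} z → c ℕ.≤ β ℕ.* 95 → c ℕ.* z ℕ.≤ β ℕ.* (95 ℕ.* z)
      *-constant≤ β z c≤ = ℕ.≤-trans (ℕ.*-monoˡ-≤ z c≤) (ℕ.≤-reflexive (ℕ.*-assoc β 95 z))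

    Den-G≤ : Den G ≤ 1ℚ + e
    Den-G≤ = Den-upper G 1 1 95 y (ℕ.≤-trans (ℕ.*-monoʳ-≤ 1 (ℕ.*-monoˡ-≤ y ∑G≤)) (ℕ.m≤m+n (1 ℕ.* (length (subtrees G) ℕ.* suc m ℕ.* y)) _))

    Den-G≥ : 1ℚ ≤ Den G + e
    Den-G≥ = Den-lower G 1 1 95 y (subst₂ ℕ._≤_ (sym (ℕ.*-identityˡ (# ℕ.* suc m ℕ.* y))) refl
      (ℕ.≤-trans (G-lower #G≥ #G≤ ∑G≥) (ℕ.+-mono-≤ (ℕ.≤-reflexive (sym (ℕ.*-identityˡ (∑ ℕ.* y))))
        (*-constant≤ 1 (# ℕ.* suc m) (ℕ.m≤m+n 30 65)))))
      where
      # ∑ : ℕ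
      # = length (subtrees G)
      ∑ = sum (map order (subtrees G))

    Den-H≤ : Den H ≤ + 2 / 3 + e
    Den-H≤ = Den-upper H 2 3 95 y (ℕ.≤-trans (H-upper #H≥ ∑H≤)
      (ℕ.+-monoʳ-≤ (2 ℕ.* (# ℕ.* suc m ℕ.* y)) (*-constant≤ 3 (# ℕ.* suc m) (ℕ.m≤m+n 95 190))))
      where
      # = length (subtrees H)

    Den-H≥ : + 2 / 3 ≤ Den H + e
    Den-H≥ = Den-lower H 2 3 95 y (ℕ.≤-trans (H-lower #H≥ #H≤ ∑H≥)
      (ℕ.+-monoʳ-≤ (3 ℕ.* (∑ ℕ.* y)) (*-constant≤ 3 (# ℕ.* suc m) (ℕ.m≤m+n 62 223))))
      where
      # ∑ : ℕ
      # = length (subtrees H)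
      ∑ = sum (map order (subtrees H))

    gap-near-1/3 : GapNear1/3 G H (+ 95 / y + + 95 / y)
    gap-near-1/3 = nearby {G = G} {H} (difference-near-1/3 {Den G} {Den H} {e} Den-G≤ Den-G≥ Den-H≤ Den-H≥)

module Subtrees where

  open import Level using (0ℓ)
  open import Data.Nat.Base using (ℕ; zero; suc; _+_; _*_; _∸_; _^_; _≤_; _<_; z≤n; s≤s; >-nonZero)
  open import Data.Nat.Properties
  open import Data.Nat.ListAction using (sum)
  open import Data.Nat.ListAction.Properties using (sum-++; sum-↭)
  open import Data.Nat.Induction using (<-wellFounded)
  open import Data.Nat.Tactic.RingSolver using (solve-∀)
  open import Induction.WellFounded using (Acc; acc)
  open import Data.Bool.Base using (true; false; if_then_else_)
  open import Data.Empty using (⊥-elim)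
  import Data.Integer.Base as ℤ
  import Data.Rational.Base as ℚ
  import Data.Rational.Unnormalised.Base as ℚᵘ
  open import Data.Fin.Base using (Fin; zero; toℕ; fromℕ<; _↑ˡ_; _↑ʳ_)
  open import Data.Fin.Properties as Fin using (toℕ-injective; toℕ-fromℕ<; toℕ-↑ˡ; toℕ-↑ʳ)
  open import Data.Fin.Subset using (Subset; _∈_; _∉_; ∣_∣; ⊤; ⊥; ⁅_⁆)
  open import Data.Fin.Subset.Properties using (_∈?_; ⊆-antisym; ∈⊤; Empty-unique; x∈⁅x⁆; x∈⁅y⁆⇒x≡y; ∣p∣≤n)
  open import Data.Vec.Base as Vec using (Vec; []; _∷_; tabulate; _++_)
  open import Data.Vec.Properties
    using (∷-injective; lookup∘tabulate; []=⇒lookup; lookup⇒[]=; tabulate∘lookup; tabulate-cong;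
           lookup-++-<; lookup-++ˡ; lookup-++ʳ; ++-injective)
  open import Data.List.Base as List
    using (List; []; _∷_; _∷ʳ_; length; map; upTo; applyUpTo; cartesianProduct; cartesianProductWith; allFin)
  import Data.List.Properties as List
  open import Data.List.Membership.Propositional using () renaming (_∈_ to _∈ˡ_)
  open import Data.List.Membership.Propositional.Properties
    using (∈-∃++; ∈-++⁺ˡ; ∈-++⁺ʳ; ∈-++⁻; ∈-map⁺; ∈-map⁻; ∈-allFin; ∈-upTo⁺; ∈-upTo⁻; ∈-cartesianProduct⁺;
           ∈-cartesianProduct⁻; ∈-cartesianProductWith⁺; ∈-cartesianProductWith⁻)
  open import Data.List.Relation.Binary.Permutation.Propositional.Properties using (shift; ∈-resp-↭; map⁺)
  open import Data.List.Relation.Unary.All as All using (All; []; _∷_)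
  open import Data.List.Relation.Unary.All.Properties using () renaming (map⁺ to All-map⁺)
  open import Data.List.Relation.Unary.AllPairs using ([]; _∷_)
  open import Data.List.Relation.Unary.Any using (here; there)
  open import Data.List.Relation.Unary.Linked using (Linked; _∷_)
  import Data.List.Relation.Unary.Linked.Properties as Linked
  open import Data.List.Relation.Unary.Unique.Propositional using (Unique)
  import Data.List.Relation.Unary.Unique.Propositional.Properties as Unique
  open import Data.Product.Base using (∃; ∃₂; _×_; _,_; proj₁; proj₂)
  open import Data.Product.Properties using (,-injective)
  open import Data.Sum.Base using (_⊎_; inj₁; inj₂; swap; [_,_])
  open import Function.Base using (_∘_; id; case_of_)
  open import Relation.Binary.Core using (Rel)
  open import Relation.Binary.Definitions using (Decidable; tri<; tri≈; tri>)
  open import Relation.Binary.Construct.Closure.ReflexiveTransitive using (Star; ε; _◅_; _◅◅_; reverse)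
  open import Relation.Binary.PropositionalEquality hiding ([_])
  open import Relation.Nullary using (¬_; does; yes; no; contradiction)
  open import Relation.Nullary.Decidable using (_×-dec_; _⊎-dec_; map′; decidable-stable; ¬?; dec-true; dec-false)
  import Relation.Unary as U
  open Arithmetic using (n<2^n; exceptions-few)
  open Densities using (GapNear1/3; module Limit; archimedean)

  private
    variable
      n : ℕ
      A B C D : Set

  -- Rooted trees: normal form, connectedness and acyclicity.

  module _ {P : Fin n → Set} (P? : U.Decidable P) where

    setOf : Subset n
    setOf = tabulate (does ∘ P?)

    ∈-setOf⁺ : ∀ {i} → P i → i ∈ setOf
    ∈-setOf⁺ {i} p = lookup⇒[]= i setOf (trans (lookup∘tabulate (does ∘ P?) i) (dec-true (P? i) p))

    ∈-setOf⁻ : ∀ {i} → i ∈ setOf → P i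
    ∈-setOf⁻ {i} i∈ with P? i | trans (sym (lookup∘tabulate (does ∘ P?) i)) ([]=⇒lookup i∈)
    ... | yes p | _  = p
    ... | no _  | ()

  setOf-unique : {P : Fin n → Set} (P? : U.Decidable P) {p : Subset n} →
                 (∀ i → i ∈ p → P i) → (∀ i → P i → i ∈ p) → p ≡ setOf P?
  setOf-unique P? to from = ⊆-antisym (∈-setOf⁺ P? ∘ to _) (from _ ∘ ∈-setOf⁻ P?)

  module Rooted (V : Subset n) {_⇑_ : Rel (Fin n) 0ℓ} (_⇑?_ : Decidable _⇑_) where

    TreeEdge : Rel (Fin n) 0ℓ
    TreeEdge i j = (i ∈ V × j ∈ V) × (i ⇑ j ⊎ j ⇑ i)

    treeEdge? : Decidable TreeEdge
    treeEdge? i j = (i ∈? V ×-dec j ∈? V) ×-dec (i ⇑? j ⊎-dec j ⇑? i)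

    rooted : Subgraph n
    rooted = ⟨ V , tabulate (setOf ∘ treeEdge?) ⟩

    rooted-edge⁺ : ∀ {i j} → TreeEdge i j → Edge rooted i j
    rooted-edge⁺ {i} {j} e =
      subst (j ∈_) (sym (lookup∘tabulate (setOf ∘ treeEdge?) i)) (∈-setOf⁺ (treeEdge? i) e)

    rooted-edge⁻ : ∀ {i j} → Edge rooted i j → TreeEdge i j
    rooted-edge⁻ {i} {j} e =
      ∈-setOf⁻ (treeEdge? i) (subst (j ∈_) (lookup∘tabulate (setOf ∘ treeEdge?) i) e)

    -- Edge sets are stored as bit matrices, so agreement of the edge relations is already
    -- propositional equality. Subtrees are identified with their normal forms through this.
    rooted-unique : (T : Subgraph n) → vertices T ≡ V →
                    (∀ i j → Edge T i j → TreeEdge i j) → (∀ i j → TreeEdge i j → Edge T i j) →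
                    T ≡ rooted
    rooted-unique ⟨ _ , E ⟩ refl to from = cong ⟨ V ,_⟩
      (trans (sym (tabulate∘lookup E)) (tabulate-cong λ i → setOf-unique (treeEdge? i) (to i) (from i)))

  open Rooted public using (rooted)

  -- Induction on the rank leads every vertex to the root; two vertices are joined by one such walk
  -- followed by the reverse of the other.
  connectedOn-descent : (V : Subset n) {E : Rel (Fin n) 0ℓ} → (∀ {i j} → E i j → E j i) →
    (rank : Fin n → ℕ) {root : Fin n} → root ∈ V →
    (∀ i → i ∈ V → i ≢ root → ∃ λ j → j ∈ V × E i j × rank j < rank i) → ConnectedOn V E
  connectedOn-descent V {E} E-sym rank {root} root∈ down =
    (root , root∈) , λ i j i∈ j∈ → go i i∈ (<-wellFounded _) ◅◅ reverse E-sym (go j j∈ (<-wellFounded _))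
    where
    go : ∀ i → i ∈ V → Acc _<_ (rank i) → Star E i root
    go i i∈ (acc rs) with i Fin.≟ root
    ... | yes refl = ε
    ... | no i≢    with j , j∈ , e , r ← down i i∈ i≢ = e ◅ go j j∈ (rs r)

  -- Non-backtracking walks, indexed by their first and their last step.
  data Walk {n} (E : Rel (Fin n) 0ℓ) : (a b y z : Fin n) → Set where
    last : ∀ {a b} → E a b → Walk E a b a b
    cons : ∀ {a b c y z} → E a b → a ≢ c → Walk E b c y z → Walk E a b y z

  firstStep : ∀ {E : Rel (Fin n) 0ℓ} {a b y z} → Walk E a b y z → E a b
  firstStep (last e)     = e
  firstStep (cons e _ _) = e

  -- Of pairwise distinctness it retains that vertices two steps apart differ; `b ≢ y` is the same
  -- condition at the base point x.
  cycle⇒walk : ∀ {E : Rel (Fin n) 0ℓ} {x ys} → IsCycle E x ys → ∃₂ λ b y → b ≢ y × Walk E x b y x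
  cycle⇒walk {E = E} {x} {b ∷ c ∷ zs} (_ , (x∉ ∷ b∉ ∷ u) , e ∷ l) =
    let y , y∈ , w = go b c zs (b∉ ∷ u) l x∉
    in b , y , All.lookup b∉ y∈ , cons e (All.head (All.tail x∉)) w
    where
    go : ∀ a b zs → Unique (a ∷ b ∷ zs) → Linked E (a ∷ b ∷ zs ∷ʳ x) → All (x ≢_) (a ∷ b ∷ zs) →
         ∃ λ y → y ∈ˡ b ∷ zs × Walk E a b y x
    go a b [] u (e ∷ e′ ∷ _) (x≢a ∷ _) = b , here refl , cons e (≢-sym x≢a) (last e′)
    go a b (c ∷ zs) ((_ ∷ a≢c ∷ _) ∷ u) (e ∷ l) (_ ∷ x∉) =
      let y , y∈ , w = go b c zs u l x∉ in y , there y∈ , cons e a≢c w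
  cycle⇒walk {ys = _ ∷ []} (s≤s () , _)

  module _ {E _⇑_ : Rel (Fin n) 0ℓ} (E⇒⇑ : ∀ {i j} → E i j → i ⇑ j ⊎ j ⇑ i)
           (⇑-functional : ∀ {i j k} → i ⇑ j → i ⇑ k → j ≡ k)
           (rank : Fin n → ℕ) (⇑-rank : ∀ {i j} → i ⇑ j → rank j < rank i) where

    private
      -- After a step from a parent to its child, a step towards the root would return to the parent
      -- just left. Hence the walk moves away from the root until its end.
      ascent : ∀ {a b y z} → Walk E a b y z → b ⇑ a → z ⇑ y × rank a < rank z
      ascent (last _) up = up , ⇑-rank up
      ascent (cons _ a≢c w) up with E⇒⇑ (firstStep w)
      ... | inj₁ b⇑c = contradiction (⇑-functional up b⇑c) a≢c
      ... | inj₂ c⇑b with up′ , r ← ascent w c⇑b = up′ , <-trans (⇑-rank up) r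

      descent : ∀ {a b y z} → Walk E a b y z → a ⇑ b → rank z < rank a ⊎ z ⇑ y
      descent (last _) down = inj₁ (⇑-rank down)
      descent (cons _ _ w) down with E⇒⇑ (firstStep w)
      ... | inj₂ c⇑b = inj₂ (proj₁ (ascent w c⇑b))
      ... | inj₁ b⇑c with descent w b⇑c
      ...   | inj₁ r = inj₁ (<-trans r (⇑-rank down))
      ...   | inj₂ u = inj₂ u

    -- A non-backtracking walk first descends towards the root and then ascends, so a closed one
    -- leaves and re-enters its base point through the parent of the latter.
    acyclic-⇑ : Acyclic E
    acyclic-⇑ (x , ys , c) with b , y , b≢y , w ← cycle⇒walk c = closed (E⇒⇑ (firstStep w))
      where
      closed : ¬ (x ⇑ b ⊎ b ⇑ x)
      closed (inj₂ up) = <-irrefl refl (proj₂ (ascent w up))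
      closed (inj₁ down) with descent w down
      ... | inj₁ r = <-irrefl refl r
      ... | inj₂ u = b≢y (⇑-functional down u)

  -- Counting along lists; intervals and gaps.

  module _ (f : A → ℕ) where

    sumBy : List A → ℕ
    sumBy = sum ∘ map f

    sumBy-++ : ∀ xs ys → sumBy (xs List.++ ys) ≡ sumBy xs + sumBy ys
    sumBy-++ xs ys = trans (cong sum (List.map-++ f xs ys)) (sum-++ (map f xs) (map f ys))

    -- Each head of `xs` is cut out of `ys`, and uniqueness keeps the remaining entries of `xs` in
    -- what is left. Repetitions in `ys` do no harm, so the covers for the upper bounds can be
    -- generous.
    sumBy-⊆ : ∀ {xs ys} → Unique xs → (∀ {x} → x ∈ˡ xs → x ∈ˡ ys) → sumBy xs ≤ sumBy ys
    sumBy-⊆ {[]}     u        xs⊆ = z≤n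
    sumBy-⊆ {x ∷ xs} {ys} (x∉ ∷ u) xs⊆ with as , bs , refl ← ∈-∃++ (xs⊆ (here refl)) =
      subst (f x + sumBy xs ≤_) (sym (sum-↭ (map⁺ f (shift x as bs)))) (+-monoʳ-≤ (f x) (sumBy-⊆ u xs⊆′))
      where
      xs⊆′ : ∀ {z} → z ∈ˡ xs → z ∈ˡ as List.++ bs
      xs⊆′ z∈ with ∈-resp-↭ (shift x as bs) (xs⊆ (there z∈))
      ... | here refl = contradiction refl (All.lookup x∉ z∈)
      ... | there z∈′ = z∈′

  length-⊆ : {xs ys : List A} → Unique xs → (∀ {x} → x ∈ˡ xs → x ∈ˡ ys) → length xs ≤ length ys
  length-⊆ {xs = xs} {ys} u xs⊆ = subst₂ _≤_ (ones xs) (ones ys) (sumBy-⊆ (λ _ → 1) u xs⊆)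
    where
    ones : ∀ {A : Set} (xs : List A) → sumBy (λ _ → 1) xs ≡ length xs
    ones []       = refl
    ones (_ ∷ xs) = cong suc (ones xs)

  module _ (f : C → ℕ) (g : A → B → C) (ys : List B) where

    private
      row≤ : ∀ {x m} (ys : List B) → (∀ y → f (g x y) ≤ m) → sumBy f (map (g x) ys) ≤ length ys * m
      row≤ []       h = z≤n
      row≤ (y ∷ ys) h = +-mono-≤ (h y) (row≤ ys h)

      row≥ : ∀ {x m} (ys : List B) → (∀ y → m ≤ f (g x y)) → length ys * m ≤ sumBy f (map (g x) ys)
      row≥ []       h = z≤n
      row≥ (y ∷ ys) h = +-mono-≤ (h y) (row≥ ys h)

    sumBy-product-≤ : (h : A → ℕ) (xs : List A) → (∀ {x} → x ∈ˡ xs → ∀ y → f (g x y) ≤ h x) →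
                      sumBy f (cartesianProductWith g xs ys) ≤ length ys * sumBy h xs
    sumBy-product-≤ h []       _     = z≤n
    sumBy-product-≤ h (x ∷ xs) bound = begin
      sumBy f (map (g x) ys List.++ cartesianProductWith g xs ys)
        ≡⟨ sumBy-++ f (map (g x) ys) _ ⟩
      sumBy f (map (g x) ys) + sumBy f (cartesianProductWith g xs ys)
        ≤⟨ +-mono-≤ (row≤ ys (bound (here refl))) (sumBy-product-≤ h xs (bound ∘ there)) ⟩
      length ys * h x + length ys * sumBy h xs
        ≡⟨ *-distribˡ-+ (length ys) (h x) _ ⟨
      length ys * (h x + sumBy h xs) ∎
      where open ≤-Reasoning

    sumBy-product-≥ : (h : A → ℕ) (xs : List A) → (∀ {x} → x ∈ˡ xs → ∀ y → h x ≤ f (g x y)) →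
                      length ys * sumBy h xs ≤ sumBy f (cartesianProductWith g xs ys)
    sumBy-product-≥ h []       _     = ≤-reflexive (*-zeroʳ (length ys))
    sumBy-product-≥ h (x ∷ xs) bound = begin
      length ys * (h x + sumBy h xs)
        ≡⟨ *-distribˡ-+ (length ys) (h x) _ ⟩
      length ys * h x + length ys * sumBy h xs
        ≤⟨ +-mono-≤ (row≥ ys (bound (here refl))) (sumBy-product-≥ h xs (bound ∘ there)) ⟩
      sumBy f (map (g x) ys) + sumBy f (cartesianProductWith g xs ys)
        ≡⟨ sumBy-++ f (map (g x) ys) _ ⟨
      sumBy f (map (g x) ys List.++ cartesianProductWith g xs ys) ∎
      where open ≤-Reasoning

  length-product : (g : A → B → C) (xs : List A) (ys : List B) →
                   length (cartesianProductWith g xs ys) ≡ length xs * length ys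
  length-product g []       ys = refl
  length-product g (x ∷ xs) ys = trans (List.length-++ (map (g x) ys))
    (cong₂ _+_ (List.length-map (g x) ys) (length-product g xs ys))

  map-unique : {f : A → B} {xs : List A} → Unique xs →
               (∀ {x y} → x ∈ˡ xs → y ∈ˡ xs → f x ≡ f y → x ≡ y) → Unique (map f xs)
  map-unique {xs = []}    []        inj = []
  map-unique {f = f} {x ∷ xs} (x∉ ∷ u) inj = All-map⁺ (All.tabulate λ y∈ eq →
      All.lookup x∉ y∈ (inj (here refl) (there y∈) eq))
    ∷ map-unique u (λ y∈ z∈ → inj (there y∈) (there z∈))

  map-product : (f : C → D) (g : A → B → C) (xs : List A) (ys : List B) →
                cartesianProductWith (λ x y → f (g x y)) xs ys ≡ map f (cartesianProductWith g xs ys)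
  map-product f g []       ys = refl
  map-product f g (x ∷ xs) ys = trans (cong₂ List._++_ (List.map-∘ ys) (map-product f g xs ys))
    (sym (List.map-++ f (map (g x) ys) _))

  ∈-vectors : {xs : List A} → (∀ x → x ∈ˡ xs) → (v : Vec A n) → v ∈ˡ vectors xs n
  ∈-vectors all []      = here refl
  ∈-vectors all (x ∷ v) = ∈-cartesianProductWith⁺ _∷_ (all x) (∈-vectors all v)

  vectors-unique : {xs : List A} → Unique xs → ∀ n → Unique (vectors xs n)
  vectors-unique u zero    = [] ∷ []
  vectors-unique u (suc n) = Unique.cartesianProductWith⁺ _∷_ ∷-injective u (vectors-unique u n)

  length-vectors : (xs : List A) → ∀ n → length (vectors xs n) ≡ length xs ^ n
  length-vectors xs zero    = refl
  length-vectors xs (suc n) = trans (length-product _∷_ xs (vectors xs n)) (cong (length xs *_) (length-vectors xs n))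

  ∈-subsets : (p : Subset n) → p ∈ˡ subsets n
  ∈-subsets = ∈-vectors λ { true → here refl ; false → there (here refl) }

  subsets-unique : ∀ n → Unique (subsets n)
  subsets-unique = vectors-unique (((λ ()) ∷ []) ∷ [] ∷ [])

  ∣++∣ : ∀ {m n} (p : Subset m) (q : Subset n) → ∣ p Vec.++ q ∣ ≡ ∣ p ∣ + ∣ q ∣
  ∣++∣ []          q = refl
  ∣++∣ (true  ∷ p) q = cong suc (∣++∣ p q)
  ∣++∣ (false ∷ p) q = ∣++∣ p q

  -- Applied to the missing path edges of a subtree with the chord and to the path vertices of a
  -- subtree of `G`. When m is added and satisfies Q, convexity between the left end and m fills
  -- what lies between.
  convex⇒interval : {Q : ℕ → Set} → U.Decidable Q → ∀ m →
    (∀ {i t j} → i < t → t < j → j < m → Q i → Q j → Q t) →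
    (∀ {t} → t < m → ¬ Q t) ⊎
    (∃₂ λ a e → a ≤ e × e < m × (∀ {t} → a ≤ t → t ≤ e → Q t) × (∀ {t} → t < m → Q t → a ≤ t × t ≤ e))
  convex⇒interval Q? zero    conv = inj₁ λ ()
  convex⇒interval {Q} Q? (suc m) conv
    with convex⇒interval Q? m (λ i<t t<j j<m → conv i<t t<j (m<n⇒m<1+n j<m)) | Q? m
  ... | inj₁ none | no ¬q = inj₁ λ t<1+m q → [ (λ t<m → none t<m q) , (λ { refl → ¬q q }) ] (m<1+n⇒m<n∨m≡n t<1+m)
  ... | inj₁ none | yes q = inj₂ (m , m , ≤-refl , ≤-refl , (λ m≤t t≤m → subst Q (≤-antisym m≤t t≤m) q) ,
    λ t<1+m q′ → [ (λ t<m → contradiction q′ (none t<m)) , (λ { refl → ≤-refl , ≤-refl }) ] (m<1+n⇒m<n∨m≡n t<1+m))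
  ... | inj₂ (a , e , a≤e , e<m , to , from) | no ¬q = inj₂ (a , e , a≤e , m<n⇒m<1+n e<m , to ,
    λ t<1+m q → [ (λ t<m → from t<m q) , (λ { refl → contradiction q ¬q }) ] (m<1+n⇒m<n∨m≡n t<1+m))
  ... | inj₂ (a , e , a≤e , e<m , to , from) | yes q = inj₂ (a , m , ≤-trans a≤e (<⇒≤ e<m) , ≤-refl , to′ ,
    λ t<1+m q′ → [ (λ t<m → proj₁ (from t<m q′) , <⇒≤ t<m) , (λ { refl → ≤-trans a≤e (<⇒≤ e<m) , ≤-refl }) ] (m<1+n⇒m<n∨m≡n t<1+m))
    where
    to′ : ∀ {t} → a ≤ t → t ≤ m → Q t
    to′ a≤t t≤m with m≤n⇒m<n∨m≡n a≤t | m≤n⇒m<n∨m≡n t≤m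
    ... | inj₁ a<t | inj₁ t<m = conv a<t t<m ≤-refl (to ≤-refl a≤e) q
    ... | inj₂ refl | _ = to ≤-refl a≤e
    ... | _ | inj₂ refl = q

  -- The pairs a ≤ t < m, where a is the last vertex before the gap and t + 2 path vertices remain.
  -- Recording t instead of the end of the gap makes the order of a subtree independent of a.
  gapPairs : ℕ → List (ℕ × ℕ)
  gapPairs zero    = []
  gapPairs (suc m) = gapPairs m List.++ map (_, m) (upTo (suc m))

  ∈-gapPairs⁺ : ∀ {a t m} → a ≤ t → t < m → (a , t) ∈ˡ gapPairs m
  ∈-gapPairs⁺ {a} {t} {suc m} a≤t t<m with m<1+n⇒m<n∨m≡n t<m
  ... | inj₁ t<m′ = ∈-++⁺ˡ (∈-gapPairs⁺ a≤t t<m′)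
  ... | inj₂ refl = ∈-++⁺ʳ (gapPairs m) (∈-map⁺ (_, m) (∈-upTo⁺ (s≤s a≤t)))

  ∈-gapPairs⁻ : ∀ {a t} m → (a , t) ∈ˡ gapPairs m → a ≤ t × t < m
  ∈-gapPairs⁻ (suc m) p∈ with ∈-++⁻ (gapPairs m) p∈
  ... | inj₁ p∈′ with a≤t , t<m ← ∈-gapPairs⁻ m p∈′ = a≤t , m<n⇒m<1+n t<m
  ... | inj₂ p∈′ with _ , a∈ , refl ← ∈-map⁻ (_, m) p∈′ = ≤-pred (∈-upTo⁻ a∈) , ≤-refl

  gapPairs-unique : ∀ m → Unique (gapPairs m)
  gapPairs-unique zero    = []
  gapPairs-unique (suc m) = Unique.++⁺ (gapPairs-unique m)
    (Unique.map⁺ (proj₁ ∘ ,-injective) (Unique.upTo⁺ (suc m)))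
    λ (p∈ , p∈′) → case ∈-map⁻ (_, m) p∈′ of λ where
      (_ , _ , refl) → <-irrefl refl (proj₂ (∈-gapPairs⁻ m p∈))

  length-gapPairs : ∀ m → 2 * length (gapPairs m) ≡ m * suc m
  length-gapPairs zero    = refl
  length-gapPairs (suc m) = begin
    2 * length (gapPairs m List.++ row)
      ≡⟨ cong (2 *_) (trans (List.length-++ (gapPairs m)) (cong (length (gapPairs m) +_) #row)) ⟩
    2 * (length (gapPairs m) + suc m)
      ≡⟨ *-distribˡ-+ 2 (length (gapPairs m)) (suc m) ⟩
    2 * length (gapPairs m) + 2 * suc m
      ≡⟨ cong (_+ 2 * suc m) (length-gapPairs m) ⟩
    m * suc m + 2 * suc m
      ≡⟨ identity m ⟩
    suc m * suc (suc m) ∎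
    where
    open ≡-Reasoning
    row = map (_, m) (upTo (suc m))
    #row : length row ≡ suc m
    #row = trans (List.length-map (_, m) (upTo (suc m))) (List.length-upTo (suc m))
    identity : ∀ m → m * suc m + 2 * suc m ≡ suc m * suc (suc m)
    identity = solve-∀

  gapOrder : ℕ × ℕ → ℕ
  gapOrder (a , t) = suc (suc t)

  sumBy-constant : ∀ {A : Set} {f : A → ℕ} {m} → (∀ x → f x ≡ m) → ∀ xs → sumBy f xs ≡ length xs * m
  sumBy-constant eq []       = refl
  sumBy-constant eq (x ∷ xs) = cong₂ _+_ (eq x) (sumBy-constant eq xs)

  -- The pairs with second entry t contribute (t + 1)(t + 2), which is the difference of consecutive
  -- values of m (m + 1)(m + 2) / 3.
  sumBy-gapOrder : ∀ m → 3 * sumBy gapOrder (gapPairs m) ≡ m * suc m * suc (suc m)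
  sumBy-gapOrder zero    = refl
  sumBy-gapOrder (suc m) = begin
    3 * sumBy gapOrder (gapPairs m List.++ row)
      ≡⟨ cong (3 *_) (trans (sumBy-++ gapOrder (gapPairs m) row) (cong (sumBy gapOrder (gapPairs m) +_) ∑row)) ⟩
    3 * (sumBy gapOrder (gapPairs m) + suc m * suc (suc m))
      ≡⟨ *-distribˡ-+ 3 (sumBy gapOrder (gapPairs m)) _ ⟩
    3 * sumBy gapOrder (gapPairs m) + 3 * (suc m * suc (suc m))
      ≡⟨ cong (_+ 3 * (suc m * suc (suc m))) (sumBy-gapOrder m) ⟩
    m * suc m * suc (suc m) + 3 * (suc m * suc (suc m))
      ≡⟨ identity m ⟩
    suc m * suc (suc m) * suc (suc (suc m)) ∎
    where
    open ≡-Reasoning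
    row = map (_, m) (upTo (suc m))
    ∑row : sumBy gapOrder row ≡ suc m * suc (suc m)
    ∑row = trans (cong sum (sym (List.map-∘ {g = gapOrder} {f = _, m} (upTo (suc m)))))
      (trans (sumBy-constant (λ _ → refl) (upTo (suc m))) (cong (_* suc (suc m)) (List.length-upTo (suc m))))
    identity : ∀ m → m * suc m * suc (suc m) + 3 * (suc m * suc (suc m)) ≡ suc m * suc (suc m) * suc (suc (suc m))
    identity = solve-∀

  -- The set omits a, ..., e - 1; the additive form avoids truncated subtraction. With e ≤ i written
  -- as e < i + 1, both conditions reduce in step as m, a and e decrease together.
  ∣outside-interval∣ : ∀ m {a e} → a ≤ e → e ≤ m →
    ∣ setOf {m} (λ i → (toℕ i <? a) ⊎-dec (e <? suc (toℕ i))) ∣ + e ≡ a + m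
  ∣outside-interval∣ zero    {zero}  {zero}  _         _         = refl
  ∣outside-interval∣ (suc m) {zero}  {zero}  _         _         = cong suc (∣outside-interval∣ m z≤n z≤n)
  ∣outside-interval∣ (suc m) {zero}  {suc e} _         (s≤s e≤m) =
    trans (+-suc _ e) (cong suc (∣outside-interval∣ m z≤n e≤m))
  ∣outside-interval∣ (suc m) {suc a} {suc e} (s≤s a≤e) (s≤s e≤m) =
    cong suc (trans (+-suc _ e) (trans (cong suc (∣outside-interval∣ m a≤e e≤m)) (sym (+-suc a m))))

  -- The graphs and the spanning trees of `H`.

  module Caterpillar (k s : ℕ) (1<k : 1 < k) where

    r N : ℕ
    r = s + s
    N = suc k + r

    -- The spanning trees, rooted at 0, of the cycle 0 1 … k with s leaves at 0 and s leaves at k.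
    -- For d < k the edge from d to d + 1 is missing, for d = k the chord from 0 to k.
    data Parent (d i j : ℕ) : Set where
      step  : i ≡ suc j → j < d → j < k → Parent d i j
      back  : d < i → i < k → j ≡ suc i → Parent d i j
      chord : d < k → i ≡ k → j ≡ 0 → Parent d i j
      leaf₀ : k < i → i ≤ k + s → j ≡ 0 → Parent d i j
      leafₖ : k + s < i → j ≡ k → Parent d i j

    k<leafₖ : ∀ {i} → k + s < i → k < i
    k<leafₖ = ≤-<-trans (m≤m+n k s)

    -- The constructors apply to disjoint ranges of i; from `step` to `leafₖ` these are 0 < i ≤ d, d
    -- < i < k, i = k > d, k < i ≤ k + s and k + s < i.
    functional : ∀ {d i j j′} → Parent d i j → Parent d i j′ → j ≡ j′
    functional (step refl _ _) (step refl _ _) = refl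
    functional (step refl j<d _) (back d<i _ _) = contradiction j<d (≤⇒≯ (≤-pred d<i))
    functional (step refl j<d _) (chord d<k refl _) = contradiction d<k (≤⇒≯ j<d)
    functional (step refl _ j<k) (leaf₀ k<i _ _) = contradiction j<k (<⇒≱ k<i)
    functional (step refl _ j<k) (leafₖ l _) = contradiction j<k (<⇒≱ (k<leafₖ l))
    functional (back d<i _ _) (step refl j<d _) = contradiction j<d (≤⇒≯ (≤-pred d<i))
    functional (back _ _ refl) (back _ _ refl) = refl
    functional (back _ i<k _) (chord _ refl _) = contradiction i<k (<-irrefl refl)
    functional (back _ i<k _) (leaf₀ k<i _ _) = contradiction i<k (<-asym k<i)
    functional (back _ i<k _) (leafₖ l _) = contradiction i<k (<-asym (k<leafₖ l))
    functional (chord d<k refl _) (step refl j<d _) = contradiction d<k (≤⇒≯ j<d)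
    functional (chord _ refl _) (back _ i<k _) = contradiction i<k (<-irrefl refl)
    functional (chord _ _ refl) (chord _ _ refl) = refl
    functional (chord _ refl _) (leaf₀ k<i _ _) = contradiction k<i (<-irrefl refl)
    functional (chord _ refl _) (leafₖ l _) = contradiction (k<leafₖ l) (<-irrefl refl)
    functional (leaf₀ k<i _ _) (step refl _ j<k) = contradiction j<k (<⇒≱ k<i)
    functional (leaf₀ k<i _ _) (back _ i<k _) = contradiction i<k (<-asym k<i)
    functional (leaf₀ k<i _ _) (chord _ refl _) = contradiction k<i (<-irrefl refl)
    functional (leaf₀ _ _ refl) (leaf₀ _ _ refl) = refl
    functional (leaf₀ _ i≤ _) (leafₖ l _) = contradiction l (≤⇒≯ i≤)
    functional (leafₖ l _) (step refl _ j<k) = contradiction j<k (<⇒≱ (k<leafₖ l))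
    functional (leafₖ l _) (back _ i<k _) = contradiction i<k (<-asym (k<leafₖ l))
    functional (leafₖ l _) (chord _ refl _) = contradiction (k<leafₖ l) (<-irrefl refl)
    functional (leafₖ l _) (leaf₀ _ i≤ _) = contradiction l (≤⇒≯ i≤)
    functional (leafₖ _ refl) (leafₖ _ refl) = refl

    parent≤k : ∀ {d i j} → Parent d i j → j ≤ k
    parent≤k (step _ _ j<k)   = <⇒≤ j<k
    parent≤k (back _ i<k refl) = i<k
    parent≤k (chord _ _ refl) = z≤n
    parent≤k (leaf₀ _ _ refl) = z≤n
    parent≤k (leafₖ _ refl)   = ≤-refl

    parentOf : ∀ d i → i ≢ 0 → ∃ (Parent d i)
    parentOf d zero    i≢0 = contradiction refl i≢0
    parentOf d (suc j) _ with suc j ≤? k | suc j ≤? d | suc j ≤? k + s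
    ... | yes j<k | yes j<d | _ = j , step refl j<d j<k
    ... | yes j<k | no j≮d  | _ with m≤n⇒m<n∨m≡n j<k
    ...   | inj₁ i<k  = suc (suc j) , back (≰⇒> j≮d) i<k refl
    ...   | inj₂ refl = 0 , chord (≰⇒> j≮d) refl refl
    parentOf d (suc j) _ | no i≰k | _ | yes i≤ = 0 , leaf₀ (≰⇒> i≰k) i≤ refl
    parentOf d (suc j) _ | no i≰k | _ | no i≰  = k , leafₖ (≰⇒> i≰) refl

    parent≢self : ∀ {d i j} → Parent d i j → i ≢ j
    parent≢self (step refl _ _)   ()
    parent≢self (back _ _ refl)   ()
    parent≢self (chord _ refl refl) refl = contradiction 1<k λ ()
    parent≢self (leaf₀ k<i _ refl) refl = contradiction k<i λ ()
    parent≢self (leafₖ l refl) refl = <-irrefl refl (k<leafₖ l)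

    parent? : ∀ d → Decidable (Parent d)
    parent? d zero j = no λ where
      (back () _ _)
      (chord _ refl _) → contradiction 1<k λ ()
      (leaf₀ () _ _)
      (leafₖ () _)
    parent? d (suc i) j with j′ , p ← parentOf d (suc i) (λ ()) = map′ (λ { refl → p }) (functional p) (j′ ≟ j)

    -- For path vertices this is the distance to the root 0, directly if i ≤ d and through the chord
    -- otherwise. Leaves receive k + 2, above every path vertex, instead of their actual depth.
    rank : ℕ → ℕ → ℕ
    rank d i = if does (i ≤? d) then i else if does (i ≤? k) then suc (k ∸ i) else suc (suc k)

    rank-low : ∀ {d i} → i ≤ d → rank d i ≡ i
    rank-low {d} {i} p rewrite dec-true (i ≤? d) p = refl

    rank-high : ∀ {d i} → d < i → i ≤ k → rank d i ≡ suc (k ∸ i)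
    rank-high {d} {i} p q rewrite dec-false (i ≤? d) (<⇒≱ p) | dec-true (i ≤? k) q = refl

    rank-leaf : ∀ {d i} → d ≤ k → k < i → rank d i ≡ suc (suc k)
    rank-leaf {d} {i} d≤k p rewrite dec-false (i ≤? d) (<⇒≱ (≤-<-trans d≤k p)) | dec-false (i ≤? k) (<⇒≱ p) = refl

    rank-path : ∀ {d i} → i ≤ k → rank d i ≤ suc k
    rank-path {d} {i} i≤k with i ≤? d
    ... | yes i≤d = ≤-trans (≤-reflexive (rank-low i≤d)) (m≤n⇒m≤1+n i≤k)
    ... | no i≰d  = ≤-trans (≤-reflexive (rank-high (≰⇒> i≰d) i≤k)) (s≤s (m∸n≤m k i))

    rank-< : ∀ {d i j} → d ≤ k → Parent d i j → rank d j < rank d i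
    rank-< d≤k (step refl j<d j<k) rewrite rank-low j<d | rank-low (<⇒≤ j<d) = ≤-refl
    rank-< {i = i} d≤k (back d<i i<k refl)
      rewrite rank-high d<i (<⇒≤ i<k) | rank-high (m<n⇒m<1+n d<i) i<k = s≤s (∸-monoʳ-< ≤-refl i<k)
    rank-< {d} d≤k (chord d<k refl refl) rewrite rank-high d<k ≤-refl | rank-low {d} {0} z≤n = s≤s z≤n
    rank-< {d} d≤k (leaf₀ k<i _ refl) rewrite rank-leaf d≤k k<i | rank-low {d} {0} z≤n = s≤s z≤n
    rank-< {d} d≤k (leafₖ l refl) rewrite rank-leaf d≤k (k<leafₖ l) = s≤s (rank-path {d} ≤-refl)

    -- Vertex i of the path, for i ≤ k; junk value 0 beyond.
    c : ℕ → Fin N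
    c i with i ≤? k
    ... | yes i≤k = fromℕ< (≤-trans (s≤s i≤k) (m≤m+n (suc k) r))
    ... | no _    = zero

    toℕ-c : ∀ {i} → i ≤ k → toℕ (c i) ≡ i
    toℕ-c {i} i≤k with i ≤? k
    ... | yes p  = toℕ-fromℕ< _
    ... | no i≰k = contradiction i≤k i≰k

    c-beyond : ∀ {i} → k < i → c i ≡ zero
    c-beyond {i} k<i with i ≤? k
    ... | yes p = contradiction k<i (≤⇒≯ p)
    ... | no _  = refl

    ≡c : ∀ {x i} → toℕ x ≡ i → i ≤ k → x ≡ c i
    ≡c eq i≤k = toℕ-injective (trans eq (sym (toℕ-c i≤k)))

    c-0 : c 0 ≡ zero
    c-0 = sym (≡c refl z≤n)

    Par : ℕ → Rel (Fin N) 0ℓ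
    Par d x y = Parent d (toℕ x) (toℕ y)

    par? : ∀ d → Decidable (Par d)
    par? d x y = parent? d (toℕ x) (toℕ y)

    parOf : ∀ d x → x ≢ zero → ∃ (Par d x)
    parOf d x x≢0 with j , p ← parentOf d (toℕ x) (x≢0 ∘ toℕ-injective) =
      c j , subst (Parent d (toℕ x)) (sym (toℕ-c (parent≤k p))) p

    G : Graph N
    G = record
      { Adj        = λ x y → Par k x y ⊎ Par k y x
      ; adj?       = λ x y → par? k x y ⊎-dec par? k y x
      ; adj-sym    = swap
      ; adj-irrefl = λ { refl (inj₁ p) → parent≢self p refl ; refl (inj₂ p) → parent≢self p refl }
      }

    0≢ck : zero ≢ c k
    0≢ck eq = contradiction (subst (1 <_) (sym (trans (cong toℕ eq) (toℕ-c ≤-refl))) 1<k) λ ()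

    ¬G-chord : ¬ Adj G zero (c k)
    ¬G-chord a rewrite toℕ-c (≤-refl {k}) = case a of λ where
      (inj₁ (back () _ _))
      (inj₁ (chord k<k _ _)) → <-irrefl refl k<k
      (inj₁ (leafₖ () _))
      (inj₂ (step refl _ _)) → <-irrefl refl 1<k
      (inj₂ (back k<k _ _)) → <-irrefl refl k<k
      (inj₂ (chord k<k _ _)) → <-irrefl refl k<k
      (inj₂ (leaf₀ k<k _ _)) → <-irrefl refl k<k
      (inj₂ (leafₖ l _)) → <-irrefl refl (k<leafₖ l)

    H : Graph N
    H = addEdge G zero (c k) 0≢ck

    G-connected : Connected G
    G-connected = connectedOn-descent ⊤ (Graph.adj-sym G) (rank k ∘ toℕ) {zero} ∈⊤
      λ x _ x≢0 → let y , p = parOf k x x≢0 in y , ∈⊤ , inj₁ p , rank-< ≤-refl p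

    -- Closure under parents keeps the descent to 0 inside V, which gives connectedness; unique
    -- parents of smaller rank exclude cycles. The graph K is arbitrary so that both `G` and `H` are
    -- served.
    rooted-isSubtree : (K : Graph N) (d : ℕ) → d ≤ k → (∀ {x y} → Par d x y → Adj K x y) →
      (V : Subset N) → zero ∈ V → (∀ {x y} → x ∈ V → Par d x y → y ∈ V) → IsSubtree K (rooted V (par? d))
    rooted-isSubtree K d d≤k adj V 0∈V closed =
      (λ i j e → let (i∈ , j∈) , p = edge⁻ e in
        sym-edge e , [ adj , Graph.adj-sym K ∘ adj ] p , i∈) ,
      connectedOn-descent V sym-edge (rank d ∘ toℕ) 0∈V
        (λ x x∈ x≢0 → let y , p = parOf d x x≢0; y∈ = closed x∈ p in
          y , y∈ , edge⁺ ((x∈ , y∈) , inj₁ p) , rank-< d≤k p) ,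
      acyclic-⇑ {_⇑_ = Par d} (proj₂ ∘ edge⁻) (λ p q → toℕ-injective (functional p q)) (rank d ∘ toℕ) (rank-< d≤k)
      where
      open Rooted V (par? d) using () renaming (rooted-edge⁺ to edge⁺; rooted-edge⁻ to edge⁻)
      sym-edge : ∀ {i j} → Edge (rooted V (par? d)) i j → Edge (rooted V (par? d)) j i
      sym-edge e with (i∈ , j∈) , p ← edge⁻ e = edge⁺ ((j∈ , i∈) , swap p)

    module _ {Q : ℕ → Set} (Q? : U.Decidable Q) where

      path : Subset (suc k)
      path = setOf (Q? ∘ toℕ)

      ∈-path⁺ : ∀ {W : Subset r} {x} → toℕ x ≤ k → Q (toℕ x) → x ∈ path ++ W
      ∈-path⁺ {W} {x} x≤k q = lookup⇒[]= x _ (trans (lookup-++-< path W x (s≤s x≤k))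
        ([]=⇒lookup (∈-setOf⁺ (Q? ∘ toℕ) (subst Q (sym (toℕ-fromℕ< (s≤s x≤k))) q))))

      ∈-path⁻ : ∀ {W : Subset r} {x} → toℕ x ≤ k → x ∈ path ++ W → Q (toℕ x)
      ∈-path⁻ {W} {x} x≤k x∈ = subst Q (toℕ-fromℕ< (s≤s x≤k)) (∈-setOf⁻ (Q? ∘ toℕ)
        (lookup⇒[]= _ path (trans (sym (lookup-++-< path W x (s≤s x≤k))) ([]=⇒lookup x∈))))

      path-unique : (V : Subset N) → (∀ x → toℕ x ≤ k → x ∈ V → Q (toℕ x)) →
                    (∀ x → toℕ x ≤ k → Q (toℕ x) → x ∈ V) → ∃ λ W → V ≡ path ++ W
      path-unique V to from with Vec.splitAt (suc k) V
      ... | P , W , refl = W , cong (_++ W) (setOf-unique (Q? ∘ toℕ)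
        (λ i i∈ → subst Q (toℕ-↑ˡ i r) (to (i ↑ˡ r) (bound i)
          (lookup⇒[]= _ (P ++ W) (trans (lookup-++ˡ P W i) ([]=⇒lookup i∈)))))
        (λ i q → lookup⇒[]= i P (trans (sym (lookup-++ˡ P W i))
          ([]=⇒lookup (from (i ↑ˡ r) (bound i) (subst Q (sym (toℕ-↑ˡ i r)) q))))))
        where
        bound : ∀ (i : Fin (suc k)) → toℕ (i ↑ˡ r) ≤ k
        bound i rewrite toℕ-↑ˡ i r = ≤-pred (Fin.toℕ<n i)

    -- What connectedness and acyclicity force on a subtree of `H`.

    module SubtreeOfH {T : Subgraph N} (T⊆H : IsSubtree H T) where

      private
        V = vertices T

      edge-sym : ∀ {x y} → Edge T x y → Edge T y x
      edge-sym e = proj₁ (proj₁ T⊆H _ _ e)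

      edge-adj : ∀ {x y} → Edge T x y → Adj H x y
      edge-adj e = proj₁ (proj₂ (proj₁ T⊆H _ _ e))

      edge-∈ : ∀ {x y} → Edge T x y → x ∈ V
      edge-∈ e = proj₂ (proj₂ (proj₁ T⊆H _ _ e))

      -- All arguments of the form "cut off from the rest" use this: X describes a part of the graph
      -- that no edge of T leaves, and T is connected.
      invariant : (X : Fin N → Set) → (∀ {x y} → Edge T x y → X x → X y) →
                  ∀ {x y} → x ∈ V → y ∈ V → X x → X y
      invariant X closed x∈ y∈ = go (proj₂ (proj₁ (proj₂ T⊆H)) _ _ x∈ y∈)
        where
        go : ∀ {x y} → Star (Edge T) x y → X x → X y
        go ε       p = p
        go (e ◅ w) p = go w (closed e p)

      -- The only neighbour of a leaf in `H` is its parent, so without that edge no edge of T leaves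
      -- x.
      leaf-isolated : ∀ {x y} → k < toℕ x → Par k x y → ¬ Edge T x y → x ∈ V → ∀ {z} → z ∈ V → z ≡ x
      leaf-isolated {x} {y} k<x p ¬e x∈ z∈ = invariant (_≡ x) closed x∈ z∈ refl
        where
        closed : ∀ {a b} → Edge T a b → a ≡ x → b ≡ x
        closed e refl with edge-adj e
        ... | inj₁ (inj₁ q) = contradiction (subst (Edge T x) (toℕ-injective (functional q p)) e) ¬e
        ... | inj₁ (inj₂ q) = contradiction (parent≤k q) (<⇒≱ k<x)
        ... | inj₂ (inj₁ (refl , _)) = contradiction k<x λ ()
        ... | inj₂ (inj₂ (refl , _)) = contradiction (subst (k <_) (toℕ-c ≤-refl) k<x) (<-irrefl refl)

      leaf-edge : ∀ {x y} → k < toℕ x → Par k x y → x ∈ V → y ∈ V → Edge T x y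
      leaf-edge {x} {y} k<x p x∈ y∈ = decidable-stable (edge? T x y) λ ¬e →
        parent≢self p (cong toℕ (sym (leaf-isolated k<x p ¬e x∈ y∈)))

      PathEdge : ℕ → Set
      PathEdge i = Edge T (c (suc i)) (c i)

      pathEdge? : U.Decidable PathEdge
      pathEdge? i = edge? T (c (suc i)) (c i)

      pathEdge⁺ : ∀ {x y} → Edge T x y → toℕ x ≡ suc (toℕ y) → toℕ y < k → PathEdge (toℕ y)
      pathEdge⁺ e eq y<k = subst₂ (Edge T) (≡c eq y<k) (≡c refl (<⇒≤ y<k)) e

      pathEdge⁻ : ∀ {x y} → PathEdge (toℕ y) → toℕ x ≡ suc (toℕ y) → toℕ y < k → Edge T x y
      pathEdge⁻ e eq y<k = subst₂ (Edge T) (sym (≡c eq y<k)) (sym (≡c refl (<⇒≤ y<k))) e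

      -- Without the edges i and j, the vertices i + 1, …, j of the path are cut off from 0.
      between-missing : ∀ {i j} → j < k → ¬ PathEdge i → ¬ PathEdge j → zero ∈ V →
                        ∀ {x} → x ∈ V → i < toℕ x → ¬ (toℕ x ≤ j)
      between-missing {i} {j} j<k ¬eᵢ ¬eⱼ 0∈ x∈ i<x x≤j =
        contradiction (proj₁ (invariant X closed x∈ 0∈ (i<x , x≤j))) λ ()
        where
        X : Fin N → Set
        X z = i < toℕ z × toℕ z ≤ j
        closed : ∀ {a b} → Edge T a b → X a → X b
        closed {a} {b} e (i<a , a≤j) with edge-adj e
        ... | inj₁ (inj₁ (step eq _ b<k)) = ≤∧≢⇒< (≤-pred (subst (i <_) eq i<a))
                (λ i≡b → ¬eᵢ (subst PathEdge (sym i≡b) (pathEdge⁺ e eq b<k))) ,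
              ≤-trans (n≤1+n _) (subst (_≤ j) eq a≤j)
        ... | inj₁ (inj₁ (back k<a a<k _)) = contradiction a<k (<-asym k<a)
        ... | inj₁ (inj₁ (chord k<k _ _)) = contradiction k<k (<-irrefl refl)
        ... | inj₁ (inj₁ (leaf₀ k<a _ _)) = contradiction (≤-<-trans a≤j j<k) (<-asym k<a)
        ... | inj₁ (inj₁ (leafₖ l _)) = contradiction (≤-<-trans a≤j j<k) (<-asym (k<leafₖ l))
        ... | inj₁ (inj₂ (step eq _ a<k)) = subst (i <_) (sym eq) (m<n⇒m<1+n i<a) ,
              subst (_≤ j) (sym eq) (≤∧≢⇒< a≤j (λ a≡j → ¬eⱼ (subst PathEdge a≡j (pathEdge⁺ (edge-sym e) eq a<k))))
        ... | inj₁ (inj₂ (back k<b b<k _)) = contradiction b<k (<-asym k<b)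
        ... | inj₁ (inj₂ (chord k<k _ _)) = contradiction k<k (<-irrefl refl)
        ... | inj₁ (inj₂ (leaf₀ _ _ eq)) = contradiction (subst (i <_) eq i<a) λ ()
        ... | inj₁ (inj₂ (leafₖ _ eq)) = contradiction (subst (_≤ j) eq a≤j) (<⇒≱ j<k)
        ... | inj₂ (inj₁ (refl , _)) = contradiction i<a λ ()
        ... | inj₂ (inj₂ (refl , _)) = contradiction (subst (_≤ j) (toℕ-c ≤-refl) a≤j) (<⇒≱ j<k)

      path-edge-missing : Edge T zero (c k) → ¬ (∀ {i} → i < k → PathEdge i)
      path-edge-missing uv all = proj₂ (proj₂ T⊆H)
        (c 0 , applyUpTo (c ∘ suc) k , subst (2 ≤_) (sym (List.length-applyUpTo (c ∘ suc) k)) 1<k ,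
         Unique.applyUpTo⁺₁ c (suc k) (λ i<j j≤k eq → <⇒≢ i<j
           (trans (sym (toℕ-c (≤-trans (<⇒≤ i<j) (≤-pred j≤k)))) (trans (cong toℕ eq) (toℕ-c (≤-pred j≤k))))) ,
         -- The default value c (k + 1) = 0 makes c 0, ..., c (k + 1) the closed cycle, with the
         -- chord as its last edge.
         subst (λ z → Linked (Edge T) (c 0 ∷ applyUpTo (c ∘ suc) k ∷ʳ z)) (trans (c-beyond ≤-refl) (sym c-0))
           (subst (Linked (Edge T)) (sym (List.applyUpTo-∷ʳ c (suc k)))
             (Linked.applyUpTo⁺₁ c (suc (suc k)) λ i<k+1 → next (m<1+n⇒m<n∨m≡n (≤-pred i<k+1)))))
        where
        next : ∀ {i} → i < k ⊎ i ≡ k → Edge T (c i) (c (suc i))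
        next (inj₁ i<k)  = edge-sym (all i<k)
        next (inj₂ refl) = subst (Edge T (c k)) (sym (c-beyond ≤-refl)) (edge-sym uv)

    -- Subtrees with a gap, and the classification of those using the chord.

    G⊆H : ∀ {T} → IsSubtree G T → IsSubtree H T
    G⊆H (sub , tree) = (λ i j e → let p , q , r = sub i j e in p , inj₁ q , r) , tree

    H-chord⊎G : ∀ {T} → IsSubtree H T → Edge T zero (c k) ⊎ IsSubtree G T
    H-chord⊎G {T} t@(sub , tree) with edge? T zero (c k)
    ... | yes e = inj₁ e
    ... | no ¬e = inj₂ ((λ i j e → proj₁ (sub i j e) , adj e (proj₁ (proj₂ (sub i j e))) , proj₂ (proj₂ (sub i j e))) , tree)
      where
      adj : ∀ {i j} → Edge T i j → Adj H i j → Adj G i j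
      adj e (inj₁ a) = a
      adj e (inj₂ (inj₁ (refl , refl))) = contradiction e ¬e
      adj e (inj₂ (inj₂ (refl , refl))) = contradiction (SubtreeOfH.edge-sym {T} t e) ¬e

    -- The vertices a + 1, …, e of the path are missing; for a = e = k there is no gap.
    Gap : ℕ → ℕ → ℕ → Set
    Gap a e i = i < suc a ⊎ suc e < suc i

    gap? : ∀ a e → U.Decidable (Gap a e)
    gap? a e i = (i <? suc a) ⊎-dec (suc e <? suc i)

    gapped : ℕ → ℕ → Subset r → Subset N
    gapped a e W = path (gap? a e) ++ W

    -- The relation `par? a` omits only the path edge from a to a + 1. The edges up to the one from
    -- e to e + 1 disappear with the vertices a + 1, ..., e.
    gapTree : ℕ → ℕ → Subset r → Subgraph N
    gapTree a e W = rooted (gapped a e W) (par? a)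

    gap-0 : ∀ {a e} → Gap a e 0
    gap-0 = inj₁ (s≤s z≤n)

    gap-k : ∀ {a e} → e < k ⊎ a ≡ k → Gap a e k
    gap-k (inj₁ e<k)  = inj₂ (s≤s e<k)
    gap-k (inj₂ refl) = inj₁ ≤-refl

    -- The hypothesis keeps the vertex k, the parent of the second group of leaves, outside the gap.
    -- A vertex beyond the gap has its parent still farther beyond, or is k itself.
    gapped-closed : ∀ {a e W} → e < k ⊎ a ≡ k → ∀ {x y} → x ∈ gapped a e W → Par a x y → y ∈ gapped a e W
    gapped-closed {a} {e} ek {x} {y} x∈ p = ∈-path⁺ (gap? a e) (parent≤k p) (gap p)
      where
      gap : Par a x y → Gap a e (toℕ y)
      gap (step _ y<a _) = inj₁ (m<n⇒m<1+n y<a)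
      gap (back a<x x<k eq) with ∈-path⁻ (gap? a e) (<⇒≤ x<k) x∈
      ... | inj₁ x≤a = contradiction a<x (≤⇒≯ (≤-pred x≤a))
      ... | inj₂ e<x = inj₂ (subst (suc e <_) (cong suc (sym eq)) (m<n⇒m<1+n e<x))
      gap (chord _ _ eq)  = subst (Gap a e) (sym eq) (gap-0 {a} {e})
      gap (leaf₀ _ _ eq)  = subst (Gap a e) (sym eq) (gap-0 {a} {e})
      gap (leafₖ _ eq)    = subst (Gap a e) (sym eq) (gap-k ek)

    gapTree-⊆H : ∀ {a e} W → a ≤ e → e < k → IsSubtree H (gapTree a e W)
    gapTree-⊆H {a} {e} W a≤e e<k = rooted-isSubtree H a (≤-trans a≤e (<⇒≤ e<k)) adj (gapped a e W)
      (∈-path⁺ (gap? a e) z≤n (gap-0 {a} {e})) (gapped-closed (inj₁ e<k))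
      where
      adj : ∀ {x y} → Par a x y → Adj H x y
      adj (step eq _ y<k)   = inj₁ (inj₁ (step eq y<k y<k))
      adj (back _ x<k eq)   = inj₁ (inj₂ (step eq x<k x<k))
      adj (chord _ x≡k y≡0) = inj₂ (inj₂ (≡c x≡k ≤-refl , toℕ-injective y≡0))
      adj (leaf₀ l l′ eq)   = inj₁ (inj₁ (leaf₀ l l′ eq))
      adj (leafₖ l eq)      = inj₁ (inj₁ (leafₖ l eq))

    fullTree-⊆G : ∀ W → IsSubtree G (gapTree k k W)
    fullTree-⊆G W = rooted-isSubtree G k ≤-refl inj₁ (gapped k k W)
      (∈-path⁺ (gap? k k) z≤n (gap-0 {k} {k})) (gapped-closed {k} {k} (inj₂ refl))

    module WithChord {T : Subgraph N} (T⊆H : IsSubtree H T) (uv : Edge T zero (c k)) where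

      open SubtreeOfH {T} T⊆H

      private
        V = vertices T

      0∈V : zero ∈ V
      0∈V = edge-∈ uv

      k∈V : c k ∈ V
      k∈V = edge-∈ (edge-sym uv)

      -- An edge t strictly between two missing edges would put the vertex t into T, although it is
      -- cut off from 0.
      missing-convex : ∀ {i t j} → i < t → t < j → j < k → ¬ PathEdge i → ¬ PathEdge j → ¬ PathEdge t
      missing-convex {i} {t} {j} i<t t<j j<k ¬i ¬j t∈ = between-missing j<k ¬i ¬j 0∈V {c t} (edge-∈ (edge-sym t∈))
        (subst (i <_) (sym t≡) i<t) (subst (_≤ j) (sym t≡) (<⇒≤ t<j))
        where
        t≡ : toℕ (c t) ≡ t
        t≡ = toℕ-c (<⇒≤ (<-trans t<j j<k))

      -- The missing path edges form an interval, nonempty because the chord would otherwise close a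
      -- cycle. Its first and last edges cut off everything between them; the remaining path edges
      -- and the leaf edges are forced.
      isGapTree : ∃₂ λ a e → a ≤ e × e < k × ∃ λ W → T ≡ gapTree a e W
      isGapTree with convex⇒interval (¬? ∘ pathEdge?) k missing-convex
      ... | inj₁ all = ⊥-elim (path-edge-missing uv λ i<k → decidable-stable (pathEdge? _) (all i<k))
      ... | inj₂ (a , e , a≤e , e<k , missing , missing⁻) = a , e , a≤e , e<k , W , T≡
        where
        a<k = ≤-<-trans a≤e e<k

        present : ∀ {t} → t < k → ¬ (a ≤ t × t ≤ e) → PathEdge t
        present t<k ¬r = decidable-stable (pathEdge? _) (¬r ∘ missing⁻ t<k)

        present< : ∀ {t} → t < a → PathEdge t
        present< t<a = present (<-trans t<a a<k) λ (a≤t , _) → <⇒≱ t<a a≤t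

        present> : ∀ {t} → e < t → t < k → PathEdge t
        present> e<t t<k = present t<k λ (_ , t≤e) → <⇒≱ e<t t≤e

        to : ∀ x → toℕ x ≤ k → x ∈ V → Gap a e (toℕ x)
        to x x≤k x∈ with toℕ x ≤? a | toℕ x ≤? e
        ... | yes x≤a | _       = inj₁ (s≤s x≤a)
        ... | no _    | no x≰e  = inj₂ (s≤s (≰⇒> x≰e))
        ... | no x≰a  | yes x≤e = contradiction x≤e
          (between-missing e<k (missing ≤-refl a≤e) (missing a≤e ≤-refl) 0∈V x∈ (≰⇒> x≰a))

        low : ∀ t → t ≤ a → c t ∈ V
        low zero    _   = subst (_∈ V) (sym c-0) 0∈V
        low (suc t) t<a = edge-∈ (present< t<a)

        from : ∀ x → toℕ x ≤ k → Gap a e (toℕ x) → x ∈ V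
        from x x≤k (inj₁ x≤a) = subst (_∈ V) (sym (≡c refl x≤k)) (low (toℕ x) (≤-pred x≤a))
        from x x≤k (inj₂ e<x) with m≤n⇒m<n∨m≡n x≤k
        ... | inj₁ x<k = subst (_∈ V) (sym (≡c refl x≤k)) (edge-∈ (edge-sym (present> (≤-pred e<x) x<k)))
        ... | inj₂ x≡k = subst (_∈ V) (sym (≡c x≡k ≤-refl)) k∈V

        W : Subset r
        W = proj₁ (path-unique (gap? a e) V to from)

        V≡ : V ≡ gapped a e W
        V≡ = proj₂ (path-unique (gap? a e) V to from)

        -- Beyond the gap a path edge changes its direction, since the root is reached there through
        -- k and the chord.
        reparent : ∀ {x y} → Edge T x y → Par k x y → Par a x y ⊎ Par a y x
        reparent {x} {y} xy (step eq _ y<k) with toℕ y <? a | toℕ y ≤? e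
        ... | yes y<a | _       = inj₁ (step eq y<a y<k)
        ... | no y≮a  | no y≰e  = inj₂ (back (≤-<-trans a≤e (≰⇒> y≰e)) y<k eq)
        ... | no y≮a  | yes y≤e = contradiction (pathEdge⁺ xy eq y<k) (missing (≮⇒≥ y≮a) y≤e)
        reparent xy (back k<x x<k _)  = contradiction x<k (<-asym k<x)
        reparent xy (chord k<k _ _)   = contradiction k<k (<-irrefl refl)
        reparent xy (leaf₀ l l′ eq)   = inj₁ (leaf₀ l l′ eq)
        reparent xy (leafₖ l eq)      = inj₁ (leafₖ l eq)

        parents : ∀ {x y} → Edge T x y → Adj H x y → Par a x y ⊎ Par a y x
        parents xy (inj₁ (inj₁ p)) = reparent xy p
        parents xy (inj₁ (inj₂ p)) = swap (reparent (edge-sym xy) p)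
        parents xy (inj₂ (inj₁ (refl , refl))) = inj₂ (chord a<k (toℕ-c ≤-refl) refl)
        parents xy (inj₂ (inj₂ (refl , refl))) = inj₁ (chord a<k (toℕ-c ≤-refl) refl)

        par-edge : ∀ {x y} → x ∈ V → y ∈ V → Par a x y → Edge T x y
        par-edge x∈ y∈ (step eq y<a y<k)   = pathEdge⁻ (present< y<a) eq y<k
        par-edge {x} x∈ y∈ (back a<x x<k eq) with to x (<⇒≤ x<k) x∈
        ... | inj₁ x≤a = contradiction a<x (≤⇒≯ (≤-pred x≤a))
        ... | inj₂ e<x = edge-sym (pathEdge⁻ (present> (≤-pred e<x) x<k) eq x<k)
        par-edge x∈ y∈ (chord _ x≡k y≡0)   =
          subst₂ (Edge T) (sym (≡c x≡k ≤-refl)) (sym (toℕ-injective y≡0)) (edge-sym uv)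
        par-edge x∈ y∈ (leaf₀ l l′ eq)     = leaf-edge l (leaf₀ l l′ eq) x∈ y∈
        par-edge x∈ y∈ (leafₖ l eq)        = leaf-edge (k<leafₖ l) (leafₖ l eq) x∈ y∈

        T≡ : T ≡ gapTree a e W
        T≡ = Rooted.rooted-unique (gapped a e W) (par? a) T V≡
          (λ x y xy → (subst (x ∈_) V≡ (edge-∈ xy) , subst (y ∈_) V≡ (edge-∈ (edge-sym xy))) , parents xy (edge-adj xy))
          λ x y ((x∈ , y∈) , p) → let x∈V = subst (x ∈_) (sym V≡) x∈; y∈V = subst (y ∈_) (sym V≡) y∈ in
            [ par-edge x∈V y∈V , edge-sym ∘ par-edge y∈V x∈V ] p

    -- Classification of the subtrees of `G`.

    Interval : ℕ → ℕ → ℕ → Set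
    Interval a e i = a ≤ i × i ≤ e

    interval? : ∀ a e → U.Decidable (Interval a e)
    interval? a e i = (a ≤? i) ×-dec (i ≤? e)

    -- The leaf sets that are empty at one end of the path: 2 · 2^s entries instead of 4^s.
    oneSided : List (Subset r)
    oneSided = map (_++ ⊥) (subsets s) List.++ map (⊥ ++_) (subsets s)

    -- A cover for the vertex sets that miss 0 or k. It contains repetitions and sets that carry no
    -- tree, as only its length, of order k² 2^s, matters.
    smallVertexSets : List (Subset N)
    smallVertexSets = map ⁅_⁆ (allFin N) List.++
      cartesianProductWith (λ (a , e) W → path (interval? a e) ++ W)
        (cartesianProduct (upTo (suc k)) (upTo (suc k))) oneSided

    fullTrees smallTrees : List (Subgraph N)
    fullTrees  = map (gapTree k k) (subsets r)
    smallTrees = map (λ V → rooted V (par? k)) smallVertexSets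

    module SubtreeOfG {T : Subgraph N} (T⊆G : IsSubtree G T) where

      open SubtreeOfH {T} (G⊆H {T} T⊆G)

      private
        V = vertices T

      adj : ∀ {x y} → Edge T x y → Par k x y ⊎ Par k y x
      adj e = proj₁ (proj₂ (proj₁ T⊆G _ _ e))

      -- Without the edge i, the vertices of the path beyond i and the leaves at k are cut off from the rest.
      between : ∀ {x y i} → x ∈ V → y ∈ V → toℕ x ≤ i → i < toℕ y → toℕ y ≤ k → PathEdge i
      between {x} {y} {i} x∈ y∈ x≤i i<y y≤k = decidable-stable (pathEdge? i) λ ¬e →
        [ (λ (i<x , _) → <⇒≱ i<x x≤i) , (λ l → <⇒≱ (≤-<-trans x≤i i<k) (<⇒≤ (k<leafₖ l))) ]
          (invariant X (closed ¬e) y∈ x∈ (inj₁ (i<y , y≤k)))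
        where
        i<k = <-≤-trans i<y y≤k
        X : Fin N → Set
        X z = (i < toℕ z × toℕ z ≤ k) ⊎ k + s < toℕ z
        closed : ¬ PathEdge i → ∀ {a b} → Edge T a b → X a → X b
        closed ¬e {a} {b} ab xa with adj ab
        closed ¬e ab (inj₁ (i<a , a≤k)) | inj₁ (step eq _ b<k) = inj₁
          (≤∧≢⇒< (≤-pred (subst (i <_) eq i<a)) (λ i≡b → ¬e (subst PathEdge (sym i≡b) (pathEdge⁺ ab eq b<k))) , <⇒≤ b<k)
        closed ¬e ab (inj₂ l) | inj₁ (step eq _ b<k) = contradiction (subst (k <_) eq (k<leafₖ l)) (≤⇒≯ b<k)
        closed ¬e ab _ | inj₁ (back k<a a<k _) = contradiction a<k (<-asym k<a)
        closed ¬e ab _ | inj₁ (chord k<k _ _) = contradiction k<k (<-irrefl refl)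
        closed ¬e ab (inj₁ (_ , a≤k)) | inj₁ (leaf₀ k<a _ _) = contradiction k<a (≤⇒≯ a≤k)
        closed ¬e ab (inj₂ l) | inj₁ (leaf₀ _ a≤ _) = contradiction l (≤⇒≯ a≤)
        closed ¬e ab _ | inj₁ (leafₖ _ eq) = inj₁ (subst (i <_) (sym eq) i<k , ≤-reflexive eq)
        closed ¬e ab (inj₁ (i<a , _)) | inj₂ (step eq _ a<k) = inj₁
          (subst (i <_) (sym eq) (m<n⇒m<1+n i<a) , subst (_≤ k) (sym eq) a<k)
        closed ¬e ab (inj₂ l) | inj₂ (step eq _ a<k) = contradiction a<k (<-asym (k<leafₖ l))
        closed ¬e ab _ | inj₂ (back k<b b<k _) = contradiction b<k (<-asym k<b)
        closed ¬e ab _ | inj₂ (chord k<k _ _) = contradiction k<k (<-irrefl refl)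
        closed ¬e ab (inj₁ (i<a , _)) | inj₂ (leaf₀ _ _ eq) = contradiction (subst (i <_) eq i<a) λ ()
        closed ¬e ab (inj₂ l) | inj₂ (leaf₀ _ _ eq) = contradiction (subst (k + s <_) eq l) λ ()
        closed ¬e ab _ | inj₂ (leafₖ l _) = inj₂ l

      path-convex : ∀ {i t j} → i < t → t < j → j < suc k → c i ∈ V → c j ∈ V → c t ∈ V
      path-convex {i} {t} {j} i<t t<j j≤k i∈ j∈ = edge-∈ (edge-sym (between i∈ j∈
        (subst (_≤ t) (sym (toℕ-c (<⇒≤ (<-trans i<t t<k)))) (<⇒≤ i<t))
        (subst (t <_) (sym (toℕ-c (≤-pred j≤k))) t<j) (≤-reflexive′ (toℕ-c (≤-pred j≤k)))))
        where
        t<k = <-≤-trans t<j (≤-pred j≤k)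
        ≤-reflexive′ : ∀ {m} → m ≡ j → m ≤ k
        ≤-reflexive′ refl = ≤-pred j≤k

      V-interval : ∃₂ λ a e → a < suc k × e < suc k × ∃ λ W → V ≡ path (interval? a e) ++ W
      V-interval with convex⇒interval (λ i → c i ∈? V) (suc k) path-convex
      -- The pair (1, 0) encodes the empty interval.
      ... | inj₁ none = 1 , 0 , m<n⇒m<1+n 1<k , s≤s z≤n , path-unique (interval? 1 0) V
        (λ x x≤k x∈ → contradiction (subst (_∈ V) (≡c refl x≤k) x∈) (none (s≤s x≤k)))
        (λ x x≤k (1≤x , x≤0) → contradiction (≤-trans 1≤x x≤0) λ ())
      ... | inj₂ (a , e , a≤e , e≤k , to , from) = a , e , ≤-<-trans a≤e e≤k , e≤k , path-unique (interval? a e) V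
        (λ x x≤k x∈ → from (s≤s x≤k) (subst (_∈ V) (≡c refl x≤k) x∈))
        (λ x x≤k (a≤x , x≤e) → subst (_∈ V) (sym (≡c refl x≤k)) (to a≤x x≤e))

      par-edge : ∀ {x y} → x ∈ V → y ∈ V → Par k x y → Edge T x y
      par-edge {x} {y} x∈ y∈ (step eq y<k _) = pathEdge⁻
        (between y∈ x∈ ≤-refl (subst (toℕ y <_) (sym eq) ≤-refl) (subst (_≤ k) (sym eq) y<k)) eq y<k
      par-edge x∈ y∈ (back k<x x<k _)    = contradiction x<k (<-asym k<x)
      par-edge x∈ y∈ (chord k<k _ _)     = contradiction k<k (<-irrefl refl)
      par-edge x∈ y∈ (leaf₀ l l′ eq)     = leaf-edge l (leaf₀ l l′ eq) x∈ y∈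
      par-edge x∈ y∈ (leafₖ l eq)        = leaf-edge (k<leafₖ l) (leafₖ l eq) x∈ y∈

      -- `G` is a tree, so an edge of `G` between two vertices of T belongs to T. Hence the vertex
      -- set determines the subtree, and it suffices to count vertex sets.
      induced : T ≡ rooted V (par? k)
      induced = Rooted.rooted-unique V (par? k) T refl
        (λ x y xy → (edge-∈ xy , edge-∈ (edge-sym xy)) , adj xy)
        λ x y ((x∈ , y∈) , p) → [ par-edge x∈ y∈ , edge-sym ∘ par-edge y∈ x∈ ] p

      full : zero ∈ V → c k ∈ V → ∃ λ W → V ≡ gapped k k W
      full 0∈ k∈ = path-unique (gap? k k) V (λ x x≤k _ → inj₁ (s≤s x≤k)) λ x x≤k _ → present x x≤k (m≤n⇒m<n∨m≡n x≤k)
        where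
        present : ∀ x → toℕ x ≤ k → toℕ x < k ⊎ toℕ x ≡ k → x ∈ V
        present x x≤k (inj₁ x<k) = subst (_∈ V) (sym (≡c refl x≤k)) (edge-∈ (edge-sym
          (between 0∈ k∈ z≤n (subst (toℕ x <_) (sym (toℕ-c ≤-refl)) x<k) (≤-reflexive (toℕ-c ≤-refl)))))
        present x x≤k (inj₂ x≡k) = subst (_∈ V) (sym (≡c x≡k ≤-refl)) k∈

      singleton : ∀ {x y} → k < toℕ x → Par k x y → x ∈ V → y ∉ V → V ∈ˡ smallVertexSets
      singleton {x} k<x p x∈ y∉ = subst (_∈ˡ smallVertexSets) (sym V≡)
        (∈-++⁺ˡ (∈-map⁺ ⁅_⁆ (∈-allFin x)))
        where
        V≡ : V ≡ ⁅ x ⁆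
        V≡ = ⊆-antisym
          (λ z∈ → subst (_∈ ⁅ x ⁆) (sym (leaf-isolated k<x p (y∉ ∘ edge-∈ ∘ edge-sym) x∈ z∈)) (x∈⁅x⁆ x))
          (λ z∈ → subst (_∈ V) (sym (x∈⁅y⁆⇒x≡y x z∈)) x∈)

      interval-small : (∀ (P : Subset (suc k)) (W : Subset r) → V ≡ P ++ W → W ∈ˡ oneSided) → V ∈ˡ smallVertexSets
      interval-small h with a , e , a≤k , e≤k , W , V≡ ← V-interval = subst (_∈ˡ smallVertexSets) (sym V≡)
        (∈-++⁺ʳ (map ⁅_⁆ (allFin N)) (∈-cartesianProductWith⁺ (λ (a , e) W → path (interval? a e) ++ W)
          (∈-cartesianProduct⁺ (∈-upTo⁺ a≤k) (∈-upTo⁺ e≤k)) (h (path (interval? a e)) W V≡)))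

      leaf∈ : ∀ {P : Subset (suc k)} {W : Subset r} {i} → V ≡ P ++ W → i ∈ W → suc k ↑ʳ i ∈ V
      leaf∈ {P} {W} {i} eq i∈ = subst (suc k ↑ʳ i ∈_) (sym eq)
        (lookup⇒[]= (suc k ↑ʳ i) (P ++ W) (trans (lookup-++ʳ P W i) ([]=⇒lookup i∈)))

      -- If a leaf at 0 is present, T is that leaf alone; otherwise the first half of the leaf set
      -- is empty.
      missing-0 : zero ∉ V → V ∈ˡ smallVertexSets
      missing-0 0∉ with Fin.any? (λ x → x ∈? V ×-dec (k <? toℕ x ×-dec toℕ x ≤? k + s))
      ... | yes (x , x∈ , l , l′) = singleton l (leaf₀ l l′ refl) x∈ 0∉
      ... | no none = interval-small h
        where
        h : ∀ P W → V ≡ P ++ W → W ∈ˡ oneSided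
        h P W V≡ with A , B , refl ← Vec.splitAt s W = subst (λ A → A ++ B ∈ˡ oneSided)
          (sym (Empty-unique λ (i , i∈) → none (suc k ↑ʳ (i ↑ˡ s) ,
            leaf∈ {P} V≡ (lookup⇒[]= (i ↑ˡ s) (A ++ B) (trans (lookup-++ˡ A B i) ([]=⇒lookup i∈))) ,
            subst (k <_) (sym (pos i)) (s≤s (m≤m+n k _)) ,
            subst (_≤ k + s) (sym (pos i)) (subst (_≤ k + s) (+-suc k (toℕ i)) (+-monoʳ-≤ k (Fin.toℕ<n i))))))
          (∈-++⁺ʳ (map (_++ ⊥) (subsets s)) (∈-map⁺ (⊥ ++_) (∈-subsets B)))
          where
          pos : ∀ i → toℕ (suc k ↑ʳ (i ↑ˡ s)) ≡ suc k + toℕ i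
          pos i = trans (toℕ-↑ʳ (suc k) (i ↑ˡ s)) (cong (suc k +_) (toℕ-↑ˡ i s))

      missing-k : c k ∉ V → V ∈ˡ smallVertexSets
      missing-k k∉ with Fin.any? (λ x → x ∈? V ×-dec (k + s <? toℕ x))
      ... | yes (x , x∈ , l) = singleton (k<leafₖ l) (leafₖ l (toℕ-c ≤-refl)) x∈ k∉
      ... | no none = interval-small h
        where
        h : ∀ P W → V ≡ P ++ W → W ∈ˡ oneSided
        h P W V≡ with A , B , refl ← Vec.splitAt s W = subst (λ B → A ++ B ∈ˡ oneSided)
          (sym (Empty-unique λ (i , i∈) → none (suc k ↑ʳ (s ↑ʳ i) ,
            leaf∈ {P} V≡ (lookup⇒[]= (s ↑ʳ i) (A ++ B) (trans (lookup-++ʳ A B i) ([]=⇒lookup i∈))) ,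
            subst (k + s <_) (sym (pos i)) (s≤s (+-monoʳ-≤ k (m≤m+n s _))))))
          (∈-++⁺ˡ (∈-map⁺ (_++ ⊥) (∈-subsets A)))
          where
          pos : ∀ i → toℕ (suc k ↑ʳ (s ↑ʳ i)) ≡ suc k + (s + toℕ i)
          pos i = trans (toℕ-↑ʳ (suc k) (s ↑ʳ i)) (cong (suc k +_) (toℕ-↑ʳ s i))

      classified : T ∈ˡ fullTrees List.++ smallTrees
      classified with zero ∈? V | c k ∈? V
      ... | no 0∉ | _ = ∈-++⁺ʳ fullTrees (subst (_∈ˡ smallTrees) (sym induced) (∈-map⁺ _ (missing-0 0∉)))
      ... | yes _ | no k∉ = ∈-++⁺ʳ fullTrees (subst (_∈ˡ smallTrees) (sym induced) (∈-map⁺ _ (missing-k k∉)))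
      ... | yes 0∈ | yes k∈ with W , V≡ ← full 0∈ k∈ = ∈-++⁺ˡ (subst (_∈ˡ fullTrees)
        (sym (trans induced (cong (λ V → rooted V (par? k)) V≡))) (∈-map⁺ (gapTree k k) (∈-subsets W)))

    -- Enumeration of the subtrees using the chord.

    -- The pair (a , t) encodes the gap a + 1, …, a + k − t − 1, which leaves t + 2 vertices of the path.
    gapEnd : ℕ → ℕ → ℕ
    gapEnd a t = a + (k ∸ suc t)

    gapEnd<k : ∀ {a t} → a ≤ t → t < k → gapEnd a t < k
    gapEnd<k {a} {t} a≤t t<k = subst (gapEnd a t <_) (m+[n∸m]≡n t<k) (+-monoˡ-< (k ∸ suc t) (s≤s a≤t))

    ∣gap∣ : ∀ {a t} → a ≤ t → t < k → ∣ path (gap? a (gapEnd a t)) ∣ ≡ suc (suc t)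
    ∣gap∣ {a} {t} a≤t t<k = +-cancelʳ-≡ (suc (gapEnd a t)) _ _ (begin
      ∣ path (gap? a (gapEnd a t)) ∣ + suc (gapEnd a t)
        ≡⟨ ∣outside-interval∣ (suc k) {suc a} {suc (gapEnd a t)} (s≤s (m≤m+n a _)) (m≤n⇒m≤1+n (gapEnd<k a≤t t<k)) ⟩
      suc a + suc k
        ≡⟨ cong (λ n → suc a + suc n) (m+[n∸m]≡n t<k) ⟨
      suc a + suc (suc t + (k ∸ suc t))
        ≡⟨ identity a t (k ∸ suc t) ⟩
      suc (suc t) + suc (gapEnd a t) ∎)
      where
      open ≡-Reasoning
      identity : ∀ a t g → suc a + suc (suc t + g) ≡ suc (suc t) + suc (a + g)
      identity = solve-∀

    ∣full∣ : ∣ path (gap? k k) ∣ ≡ suc k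
    ∣full∣ = +-cancelʳ-≡ (suc k) _ _ (∣outside-interval∣ (suc k) {suc k} {suc k} ≤-refl ≤-refl)

    chordTree : ℕ × ℕ → Subset r → Subgraph N
    chordTree (a , t) = gapTree a (gapEnd a t)

    chordTrees : List (Subgraph N)
    chordTrees = cartesianProductWith chordTree (gapPairs k) (subsets r)

    order-chordTree : ∀ {a t} W → a ≤ t → t < k → order (chordTree (a , t) W) ≡ suc (suc t) + ∣ W ∣
    order-chordTree {a} {t} W a≤t t<k = trans (∣++∣ (path (gap? a (gapEnd a t))) W) (cong (_+ ∣ W ∣) (∣gap∣ a≤t t<k))

    gap-edge : ∀ {a e W} → a ≤ k → ∀ {i} → i < a → Edge (gapTree a e W) (c (suc i)) (c i)
    gap-edge {a} {e} {W} a≤k {i} i<a = Rooted.rooted-edge⁺ (gapped a e W) (par? a)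
      ((member i<a , member (<⇒≤ i<a)) ,
       inj₁ (step (trans (toℕ-c i<k) (sym (cong suc (toℕ-c (<⇒≤ i<k))))) (subst (_< a) (sym (toℕ-c (<⇒≤ i<k))) i<a)
         (subst (_< k) (sym (toℕ-c (<⇒≤ i<k))) i<k)))
      where
      i<k = <-≤-trans i<a a≤k
      member : ∀ {j} → j ≤ a → c j ∈ gapped a e W
      member j≤a = ∈-path⁺ (gap? a e) (subst (_≤ k) (sym (toℕ-c (≤-trans j≤a a≤k))) (≤-trans j≤a a≤k))
        (inj₁ (s≤s (subst (_≤ a) (sym (toℕ-c (≤-trans j≤a a≤k))) j≤a)))

    gap-nonedge : ∀ {a e W} → a < k → ¬ Edge (gapTree a e W) (c (suc a)) (c a)
    gap-nonedge {a} {e} {W} a<k ab = impossible (toℕ-c a<k) (toℕ-c (<⇒≤ a<k))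
      (proj₂ (Rooted.rooted-edge⁻ (gapped a e W) (par? a) {c (suc a)} {c a} ab))
      where
      impossible : ∀ {i j} → i ≡ suc a → j ≡ a → ¬ (Parent a i j ⊎ Parent a j i)
      impossible refl refl (inj₁ (step _ a<a _))    = <-irrefl refl a<a
      impossible refl refl (inj₁ (back _ _ eq))     = contradiction eq λ ()
      impossible refl refl (inj₁ (chord _ eq refl)) = <-irrefl eq 1<k
      impossible refl refl (inj₁ (leaf₀ l _ _))     = <⇒≱ l a<k
      impossible refl refl (inj₁ (leafₖ l _))       = <⇒≱ (k<leafₖ l) a<k
      impossible refl refl (inj₂ (step () _ _))
      impossible refl refl (inj₂ (back a<a _ _))    = <-irrefl refl a<a
      impossible refl refl (inj₂ (chord _ eq _))    = <-irrefl eq a<k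
      impossible refl refl (inj₂ (leaf₀ l _ _))     = <-asym l a<k
      impossible refl refl (inj₂ (leafₖ l _))       = <-asym (k<leafₖ l) a<k

    -- The path edge from a to a + 1 is missing from the first tree and present in the second.
    gapTree-≢ : ∀ {a a′ e e′ W W′} → a < a′ → a′ ≤ k → gapTree a e W ≢ gapTree a′ e′ W′
    gapTree-≢ {a} {a′} {e} {e′} {W} {W′} a<a′ a′≤k eq = gap-nonedge {a} {e} {W} (<-≤-trans a<a′ a′≤k)
      (subst (λ T → Edge T (c (suc a)) (c a)) (sym eq) (gap-edge {a′} {e′} {W′} a′≤k a<a′))

    -- The vertex set yields W, and t by its size, but not always a: for t = k - 1 no path vertex is
    -- missing. Therefore a is recovered from the edges.
    chordTree-injective : ∀ {a t a′ t′ W W′} → a ≤ t → t < k → a′ ≤ t′ → t′ < k →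
      chordTree (a , t) W ≡ chordTree (a′ , t′) W′ → ((a , t) , W) ≡ ((a′ , t′) , W′)
    chordTree-injective {a} {t} {a′} {t′} {W} {W′} a≤t t<k a′≤t′ t′<k eq
      with ++-injective (path (gap? a (gapEnd a t))) (path (gap? a′ (gapEnd a′ t′))) (cong vertices eq)
    ... | P≡ , W≡ = cong₂ _,_ (cong₂ _,_ a≡ t≡) W≡
      where
      t≡ : t ≡ t′
      t≡ = suc-injective (suc-injective (trans (sym (∣gap∣ a≤t t<k)) (trans (cong ∣_∣ P≡) (∣gap∣ a′≤t′ t′<k))))
      a≡ : a ≡ a′
      a≡ with <-cmp a a′
      ... | tri≈ _ a≡a′ _ = a≡a′
      ... | tri< a<a′ _ _ = contradiction eq (gapTree-≢ {e = gapEnd a t} {e′ = gapEnd a′ t′} {W = W} {W′ = W′} a<a′ (≤-trans a′≤t′ (<⇒≤ t′<k)))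
      ... | tri> _ _ a′<a = contradiction (sym eq) (gapTree-≢ {e = gapEnd a′ t′} {e′ = gapEnd a t} {W = W′} {W′ = W} a′<a (≤-trans a≤t (<⇒≤ t<k)))

    chordTrees-unique : Unique chordTrees
    chordTrees-unique = subst Unique (sym (map-product (λ (p , W) → chordTree p W) _,_ (gapPairs k) (subsets r)))
      (map-unique (Unique.cartesianProduct⁺ (gapPairs-unique k) (subsets-unique r)) λ x∈ y∈ eq →
        let a≤t , t<k = ∈-gapPairs⁻ k (proj₁ (∈-cartesianProduct⁻ (gapPairs k) (subsets r) x∈))
            a′≤t′ , t′<k = ∈-gapPairs⁻ k (proj₁ (∈-cartesianProduct⁻ (gapPairs k) (subsets r) y∈))
        in chordTree-injective a≤t t<k a′≤t′ t′<k eq)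

    fullTrees-unique : Unique fullTrees
    fullTrees-unique = Unique.map⁺ (λ eq → proj₂ (++-injective (path (gap? k k)) _ (cong vertices eq))) (subsets-unique r)

    chordTrees-sound : ∀ {T} → T ∈ˡ chordTrees → IsSubtree H T
    chordTrees-sound T∈ with (a , t) , W , p∈ , _ , refl ← ∈-cartesianProductWith⁻ chordTree (gapPairs k) (subsets r) T∈
      = let a≤t , t<k = ∈-gapPairs⁻ k p∈ in gapTree-⊆H {a} {gapEnd a t} W (m≤m+n a _) (gapEnd<k a≤t t<k)

    fullTrees-sound : ∀ {T} → T ∈ˡ fullTrees → IsSubtree G T
    fullTrees-sound T∈ with W , _ , refl ← ∈-map⁻ (gapTree k k) {xs = subsets r} T∈ = fullTree-⊆G W

    H-classified : ∀ {T} → IsSubtree H T → T ∈ˡ chordTrees List.++ (fullTrees List.++ smallTrees)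
    H-classified {T} T⊆H with H-chord⊎G {T} T⊆H
    ... | inj₂ T⊆G = ∈-++⁺ʳ chordTrees (SubtreeOfG.classified {T} T⊆G)
    ... | inj₁ uv with a , e , a≤e , e<k , W , refl ← WithChord.isGapTree {T} T⊆H uv
      = ∈-++⁺ˡ (subst (_∈ˡ chordTrees) (cong (λ e → gapTree a e W) end≡)
          (∈-cartesianProductWith⁺ chordTree (∈-gapPairs⁺ {a} {t} a≤t t<k) (∈-subsets W)))
      where
      -- Solves `gapEnd a t` = e: without e - a vertices, the path retains k + 1 - (e - a) = t + 2.
      t = k ∸ suc (e ∸ a)
      g<k : e ∸ a < k
      g<k = ≤-<-trans (m∸n≤m e a) e<k
      t<k : t < k
      t<k = ∸-monoʳ-< {k} {suc (e ∸ a)} {0} (s≤s z≤n) g<k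
      a≤t : a ≤ t
      a≤t = m+n≤o⇒m≤o∸n a (subst (_≤ k) (sym (trans (+-suc a (e ∸ a)) (cong suc (m+[n∸m]≡n a≤e)))) e<k)
      end≡ : gapEnd a t ≡ e
      end≡ = begin
        a + (k ∸ suc t)                 ≡⟨ cong (λ z → a + (k ∸ z)) (+-∸-assoc 1 g<k) ⟨
        a + (k ∸ (k ∸ (e ∸ a)))         ≡⟨ cong (a +_) (m∸[m∸n]≡n (<⇒≤ g<k)) ⟩
        a + (e ∸ a)                     ≡⟨ m+[n∸m]≡n a≤e ⟩
        e ∎
        where open ≡-Reasoning

    chordTrees⊆H : ∀ {T} → T ∈ˡ chordTrees → T ∈ˡ subtrees H
    chordTrees⊆H {T} T∈ = subtrees-complete H {T} (chordTrees-sound T∈)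

    fullTrees⊆G : ∀ {T} → T ∈ˡ fullTrees → T ∈ˡ subtrees G
    fullTrees⊆G {T} T∈ = subtrees-complete G {T} (fullTrees-sound T∈)

    G⊆cover : ∀ {T} → T ∈ˡ subtrees G → T ∈ˡ fullTrees List.++ smallTrees
    G⊆cover {T} T∈ = SubtreeOfG.classified {T} (subtrees-sound G {T} T∈)

    H⊆cover : ∀ {T} → T ∈ˡ subtrees H → T ∈ˡ chordTrees List.++ (fullTrees List.++ smallTrees)
    H⊆cover {T} T∈ = H-classified (subtrees-sound H {T} T∈)

    -- Bounds on the numbers of subtrees and on the sums of their orders.

    #leafSets #gaps ∑gaps #small : ℕ
    #leafSets = 2 ^ r
    #gaps = length (gapPairs k)
    ∑gaps = sumBy gapOrder (gapPairs k)
    #small = length smallTrees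

    length-smallTrees : #small ≡ N + suc k * suc k * (2 ^ s + 2 ^ s)
    length-smallTrees = begin
      length smallTrees ≡⟨ List.length-map _ smallVertexSets ⟩
      length smallVertexSets ≡⟨ List.length-++ (map ⁅_⁆ (allFin N)) ⟩
      length (map ⁅_⁆ (allFin N)) + _
        ≡⟨ cong₂ _+_ (trans (List.length-map ⁅_⁆ (allFin N)) (List.length-tabulate {n = N} id))
             (length-product _ (cartesianProduct (upTo (suc k)) (upTo (suc k))) oneSided) ⟩
      N + length (cartesianProduct (upTo (suc k)) (upTo (suc k))) * length oneSided
        ≡⟨ cong₂ (λ a b → N + a * b)
             (trans (length-product _,_ (upTo (suc k)) (upTo (suc k)))
               (cong₂ _*_ (List.length-upTo (suc k)) (List.length-upTo (suc k))))
             (trans (List.length-++ (map (_++ ⊥) (subsets s)))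
               (cong₂ _+_ (side (_++ ⊥)) (side (⊥ ++_)))) ⟩
      N + suc k * suc k * (2 ^ s + 2 ^ s) ∎
      where
      open ≡-Reasoning
      side : (f : Subset s → Subset r) → length (map f (subsets s)) ≡ 2 ^ s
      side f = trans (List.length-map f (subsets s)) (length-vectors _ s)

    length-fullTrees : length fullTrees ≡ #leafSets
    length-fullTrees = trans (List.length-map _ (subsets r)) (length-vectors _ r)

    length-cover : length (fullTrees List.++ smallTrees) ≡ #leafSets + #small
    length-cover = trans (List.length-++ fullTrees) (cong (_+ #small) length-fullTrees)

    length-chordTrees : length chordTrees ≡ #leafSets * #gaps
    length-chordTrees = trans (length-product chordTree (gapPairs k) (subsets r))
      (trans (cong (#gaps *_) (length-vectors _ r)) (*-comm #gaps #leafSets))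

    #G≥ : #leafSets ≤ length (subtrees G)
    #G≥ = ≤-trans (≤-reflexive (sym length-fullTrees)) (length-⊆ fullTrees-unique fullTrees⊆G)

    #G≤ : length (subtrees G) ≤ #leafSets + #small
    #G≤ = ≤-trans (length-⊆ (subtrees-unique G) G⊆cover) (≤-reflexive length-cover)

    sumBy-order≤ : ∀ {n} (Ts : List (Subgraph n)) → sumBy order Ts ≤ length Ts * n
    sumBy-order≤ []       = z≤n
    sumBy-order≤ (T ∷ Ts) = +-mono-≤ (∣p∣≤n (vertices T)) (sumBy-order≤ Ts)

    ∑G≤ : sumBy order (subtrees G) ≤ length (subtrees G) * N
    ∑G≤ = sumBy-order≤ (subtrees G)

    -- Each full tree contributes at least the k + 1 path vertices; its leaves are ignored.
    ∑G≥ : #leafSets * suc k ≤ sumBy order (subtrees G)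
    ∑G≥ = ≤-trans (subst (λ b → b * suc k ≤ sumBy order fullTrees) (length-vectors _ r) (bound (subsets r)))
      (sumBy-⊆ order fullTrees-unique fullTrees⊆G)
      where
      bound : ∀ Ws → length Ws * suc k ≤ sumBy order (map (gapTree k k) Ws)
      bound []       = z≤n
      bound (W ∷ Ws) = +-mono-≤ (≤-trans (≤-trans (≤-reflexive (sym ∣full∣)) (m≤m+n _ ∣ W ∣))
        (≤-reflexive (sym (∣++∣ (path (gap? k k)) W)))) (bound Ws)

    #H≥ : #leafSets * #gaps ≤ length (subtrees H)
    #H≥ = ≤-trans (≤-reflexive (sym length-chordTrees)) (length-⊆ chordTrees-unique chordTrees⊆H)

    #H≤ : length (subtrees H) ≤ #leafSets * #gaps + (#leafSets + #small)
    #H≤ = ≤-trans (length-⊆ (subtrees-unique H) H⊆cover)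
      (≤-reflexive (trans (List.length-++ chordTrees) (cong₂ _+_ length-chordTrees length-cover)))

    ∑H≥ : #leafSets * ∑gaps ≤ sumBy order (subtrees H)
    ∑H≥ = ≤-trans (subst (λ b → b * ∑gaps ≤ sumBy order chordTrees) (length-vectors _ r)
        (sumBy-product-≥ order chordTree (subsets r) gapOrder (gapPairs k) λ p∈ W →
          let a≤t , t<k = ∈-gapPairs⁻ k p∈ in ≤-trans (m≤m+n _ ∣ W ∣) (≤-reflexive (sym (order-chordTree W a≤t t<k)))))
      (sumBy-⊆ order chordTrees-unique chordTrees⊆H)

    -- A subtree with the chord is charged its path vertices and all r leaves, every other member of
    -- the cover the trivial bound N.
    ∑H≤ : sumBy order (subtrees H) ≤ #leafSets * (∑gaps + #gaps * r) + (#leafSets + #small) * N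
    ∑H≤ = begin
      sumBy order (subtrees H)
        ≤⟨ sumBy-⊆ order (subtrees-unique H) H⊆cover ⟩
      sumBy order (chordTrees List.++ (fullTrees List.++ smallTrees))
        ≡⟨ sumBy-++ order chordTrees _ ⟩
      sumBy order chordTrees + sumBy order (fullTrees List.++ smallTrees)
        ≤⟨ +-mono-≤ (sumBy-product-≤ order chordTree (subsets r) (λ p → gapOrder p + r) (gapPairs k) (λ p∈ W →
             let a≤t , t<k = ∈-gapPairs⁻ k p∈ in ≤-trans (≤-reflexive (order-chordTree W a≤t t<k)) (+-monoʳ-≤ _ (∣p∣≤n W))))
             (sumBy-order≤ (fullTrees List.++ smallTrees)) ⟩
      length (subsets r) * sumBy (λ p → gapOrder p + r) (gapPairs k) + length (fullTrees List.++ smallTrees) * N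
        ≡⟨ cong₂ _+_ (cong₂ _*_ (length-vectors _ r) (shifted (gapPairs k))) (cong (_* N) length-cover) ⟩
      #leafSets * (∑gaps + #gaps * r) + (#leafSets + #small) * N ∎
      where
      open ≤-Reasoning
      shifted : ∀ ps → sumBy (λ p → gapOrder p + r) ps ≡ sumBy gapOrder ps + length ps * r
      shifted []       = refl
      shifted (p ∷ ps) = trans (cong (gapOrder p + r +_) (shifted ps)) (identity (gapOrder p) r (sumBy gapOrder ps) (length ps * r))
        where
        identity : ∀ o r x y → o + r + (x + y) ≡ o + x + (r + y)
        identity = solve-∀

    gap-near-1/3 : ∀ {y} → (1≤y : 1 ≤ y) → y * y ≤ k → r ≤ 10 * y → #small * y ≤ 20 * #leafSets →
      let instance _ = >-nonZero 1≤y in GapNear1/3 {k + r} G H (ℤ.+ 95 ℚ./ y ℚ.+ ℤ.+ 95 ℚ./ y)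
    gap-near-1/3 {y} 1≤y y²≤k r≤10y Ey≤20B = Limit.gap-near-1/3 {k + r} G H {#leafSets} {#small} {#gaps} {∑gaps} {k} {r} {y} refl
      1≤y y²≤k r≤10y Ey≤20B (length-gapPairs k) (sumBy-gapOrder k) #G≥ #G≤ ∑G≥ ∑G≤ #H≥ #H≤ ∑H≥ ∑H≤


  -- Choice of the parameters.

  module Parameters (t : ℕ) (1<y : 1 < 2 ^ t) where

    -- With y a power of two, 2^s = y⁵ holds exactly. The exponent 5 comes from the roughly k² 2^s =
    -- y⁴ 2^s exceptional subtrees, which have to be O(1/y) of the 4^s full ones. With k = y² the 10
    -- t leaves, at most 10 y, are few against the path.
    y k s L : ℕ
    y = 2 ^ t
    k = y * y
    s = t * 5
    L = y * y * y * y * y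

    1<k : 1 < k
    1<k = <-≤-trans 1<y (m≤m*n y y {{>-nonZero (<⇒≤ 1<y)}})

    2^s≡L : 2 ^ s ≡ L
    2^s≡L = trans (sym (^-*-assoc 2 t 5)) (identity y)
      where
      identity : ∀ y → y * (y * (y * (y * (y * 1)))) ≡ y * y * y * y * y
      identity = solve-∀

    s+s≤10y : s + s ≤ 10 * y
    s+s≤10y = ≤-trans (≤-reflexive (identity t)) (*-monoʳ-≤ 10 (<⇒≤ (n<2^n t)))
      where
      identity : ∀ t → t * 5 + t * 5 ≡ 10 * t
      identity = solve-∀

    small-bound : (suc k + (s + s) + suc k * suc k * (2 ^ s + 2 ^ s)) * y ≤ 20 * 2 ^ (s + s)
    small-bound = begin
      (suc k + (s + s) + suc k * suc k * (2 ^ s + 2 ^ s)) * y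
        ≡⟨ cong (λ l → (suc k + (s + s) + suc k * suc k * (l + l)) * y) 2^s≡L ⟩
      (suc k + (s + s) + suc k * suc k * (L + L)) * y
        ≤⟨ exceptions-few {y} {s + s} (<⇒≤ 1<y) s+s≤10y ⟩
      20 * (L * L)
        ≡⟨ cong (20 *_) (trans (^-distribˡ-+-* 2 s s) (cong₂ _*_ 2^s≡L 2^s≡L)) ⟨
      20 * 2 ^ (s + s) ∎
      where open ≤-Reasoning

    gap-near-1/3 : let instance _ = >-nonZero (<⇒≤ 1<y) in
      GapNear1/3 (Caterpillar.G k s 1<k) (Caterpillar.H k s 1<k) (ℤ.+ 95 ℚ./ y ℚ.+ ℤ.+ 95 ℚ./ y)
    gap-near-1/3 = Caterpillar.gap-near-1/3 k s 1<k (<⇒≤ 1<y) ≤-refl s+s≤10y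
      (subst (λ e → e * y ≤ 20 * 2 ^ (s + s)) (sym (Caterpillar.length-smallTrees k s 1<k)) small-bound)

  caterpillar-near-1/3 : ∀ δ → ℚ.0ℚ ℚ.< δ → ∃₂ λ k s → ∃₂ λ (1<k : 1 < k) e →
    GapNear1/3 (Caterpillar.G k s 1<k) (Caterpillar.H k s 1<k) e × e ℚ.< δ
  caterpillar-near-1/3 δ 0<δ = k , s , 1<k , _ , gap-near-1/3 ,
    archimedean δ 0<δ 95 (2 ^ t) {{>-nonZero (<⇒≤ 1<2^t)}} (n<2^n t)
    where
    t : ℕ
    -- Here 190 = 2 · 95, so that t < 2^t is the bound on y = 2^t required by `archimedean`.
    t = 190 * ℚᵘ.↧ₙ (ℚ.toℚᵘ δ)
    1<2^t : 1 < 2 ^ t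
    1<2^t = ≤-<-trans (s≤s z≤n) (n<2^n t)
    open Parameters t 1<2^t

open Subtrees using (module Caterpillar; caterpillar-near-1/3)
open Densities using (distance)
open import Data.Nat.Base using (ℕ; suc; _+_)
open import Data.Integer.Base using (+_)
open import Data.Fin.Base using (Fin; zero)
open import Data.Rational.Base using (ℚ; 0ℚ; _<_; _-_; _/_; ∣_∣)
open import Data.Rational.Properties using (≤-<-trans)
open import Data.Product.Base using (Σ-syntax; _×_; _,_)
open import Relation.Binary.PropositionalEquality using (_≢_)
open import Relation.Nullary using (¬_)

theorem3p1 : (ε : ℚ) → 0ℚ < ε →
    Σ[ m ∈ ℕ ] Σ[ G ∈ Graph (suc m) ] (Connected G ×
    (Σ[ u ∈ Fin (suc m) ] Σ[ v ∈ Fin (suc m) ] Σ[ u≢v ∈ u ≢ v ]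
    (¬ Adj G u v ×
    ∣ (Den G - Den (addEdge G u v u≢v)) - (+ 1 / 3) ∣ < ε)))
theorem3p1 ε 0<ε =
  let k , s , 1<k , e , near , e<ε = caterpillar-near-1/3 ε 0<ε
      G = Caterpillar.G k s 1<k
      v = Caterpillar.c k s 1<k k
      u≢v = Caterpillar.0≢ck k s 1<k
  in k + (s + s) , G , Caterpillar.G-connected k s 1<k , zero , v , u≢v , Caterpillar.¬G-chord k s 1<k ,
     ≤-<-trans (distance {k + (s + s)} {G} {addEdge G zero v u≢v} near) e<ε
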